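{- Let $r,t,\ell,m$ be integers with $1 \le t \le \ell \le m$ and $1 \le r \le \ell$. Then $$\mathfrak{w}_r(t;\ell,m) = \frac{q-1}{q}\sum_{s=1}^r q^{\binom{s}{2}}\left(\frac{[m]_q!}{[m-t]_q!} - (-1)^s \frac{[m-s]_q!}{[m-t]_q!} \right)q^{s(\ell-r)}q^{\binom{t-s}{2}}{r\brack s}_q {\ell-r\brack t-s}_q$$ $$=\frac{q-1}{q}\left(\mu_t(\ell,m) -\sum_{s=0}^r (-1)^s q^{\binom{s}{2}} \frac{[m-s]_q!}{[m-t]_q!}\,q^{s(\ell-r)}\,q^{\binom{t-s}{2}}{r\brack s}_q {\ell-r\brack t-s}_q\right),$$ where terms with $s>t$ vanish because the Gaussian binomial ${\ell-r\brack t-s}_q$ is then $0$.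
   Context: $q$ is a prime power. $\mu_t(\ell,m)$ is the number of $\ell\times m$ matrices over $\mathbb{F}_q$ of rank exactly $t$. For an $\ell\times m$ matrix $M=(m_{ij})$, $\tau_r(M)=m_{11}+\cdots+m_{rr}$, and $\mathfrak w_r(t;\ell,m)$ is the number of $\ell\times m$ matrices $M$ over $\mathbb{F}_q$ with $\mathrm{rk}(M)=t$ and $\tau_r(M)\ne 0$. The Gaussian factorial is $[n]_q!=\prod_{i=1}^n(q^i-1)$ (with $[0]_q!=1$), and ${n\brack k}_q$ is the Gaussian binomial coefficient, equal to $0$ if $k<0$ or $k>n$. -}

module Defs where

open import Algebra.Bundles using (CommutativeRing)
open import Algebra.Structures using (IsCommutativeRing)
import Algebra.Properties.CommutativeMonoid.Sum as Sum
open import Data.Fin.Base using (Fin; inject≤; toℕ)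
open import Data.Fin.Properties using (inj⇒≟)
open import Data.Integer.Base as ℤ using (ℤ; +_; -[1+_])
open import Data.List.Base as List using (List; []; _∷_; allFin; cartesianProductWith; filter; length)
open import Data.List.Membership.Propositional using (_∈_; find; lose)
open import Data.List.Membership.Propositional.Properties
  using (∈-allFin; ∈-map⁺; ∈-cartesianProductWith⁺)
open import Data.List.Relation.Unary.Any using (here; any?)
open import Data.Nat.Base as ℕ
  using (ℕ; zero; suc; _∸_; _≤_; NonZero; NonTrivial; nonTrivial⇒nonZero; nonTrivial⇒n>1)
import Data.Nat.Properties as ℕ
open import Data.Product.Base using (Σ-syntax; ∃; ∃-syntax; _×_; _,_)
open import Data.Rational.Base as ℚ using (ℚ; 0ℚ)
open import Data.Rational.Properties using (+-0-commutativeMonoid)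
open import Data.Vec.Base using (Vec; []; _∷_; lookup; tabulate; replicate)
import Data.Vec.Properties as Vec
open import Function.Bundles using (_↔_; module Inverse; _⇔_; mk⇔; module Equivalence)
open import Function.Properties.Inverse using (↔⇒↣; ↔-sym)
open import Relation.Binary.Definitions using (DecidableEquality)
open import Relation.Binary.PropositionalEquality using (_≡_; _≢_; refl; subst)
open import Relation.Nullary.Decidable using (Dec; yes; no; ¬?; map′; _×-dec_; _→-dec_; decidable-stable)
open import Relation.Unary using (Decidable)

-- The finite fields with q elements. (The existence of such a field forces
-- q to be a prime power.)

record FiniteField (q : ℕ) : Set₁ where
  infix  8 -_
  infixl 7 _*_
  infixl 6 _+_
  field
    Carrier           : Set
    _+_ _*_           : Carrier → Carrier → Carrier
    -_                : Carrier → Carrier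
    0# 1#             : Carrier
    isCommutativeRing : IsCommutativeRing _≡_ _+_ _*_ -_ 0# 1#
    0≢1               : 0# ≢ 1#
    inverse           : ∀ x → x ≢ 0# → ∃[ y ] x * y ≡ 1#
    enumeration       : Fin q ↔ Carrier

  commutativeRing : CommutativeRing _ _
  commutativeRing = record { isCommutativeRing = isCommutativeRing }

  open CommutativeRing commutativeRing public using (+-commutativeMonoid)

  _≟_ : DecidableEquality Carrier
  _≟_ = inj⇒≟ (↔⇒↣ (↔-sym enumeration))

  elements : List Carrier
  elements = List.map (Inverse.to enumeration) (allFin q)

-- All vectors with entries in xs, each listed once if xs has no repetitions.

allVecs : ∀ {A : Set} → List A → ∀ n → List (Vec A n)
allVecs xs zero    = [] ∷ []
allVecs xs (suc n) = cartesianProductWith _∷_ xs (allVecs xs n)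

allVecs-complete : ∀ {A : Set} {xs : List A} → (∀ x → x ∈ xs) →
                   ∀ {n} (v : Vec A n) → v ∈ allVecs xs n
allVecs-complete all []      = here refl
allVecs-complete all (x ∷ v) =
  ∈-cartesianProductWith⁺ _∷_ (all x) (allVecs-complete all v)

module _ {A : Set} {xs : List A} (complete : ∀ x → x ∈ xs)
         {P : A → Set} (P? : Decidable P) where

  exists? : Dec (∃ P)
  exists? = map′ (λ any → let x , _ , px = find any in x , px)
                 (λ (x , px) → lose (complete x) px)
                 (any? P? xs)

module _ {A : Set} {xs : List A} (complete : ∀ x → x ∈ xs)
         {P : A → Set} (P? : Decidable P) where

  forall? : Dec (∀ x → P x)
  forall? with exists? complete (λ x → ¬? (P? x))
  ... | yes (x , ¬px) = no λ all → ¬px (all x)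
  ... | no  ¬∃        = yes λ x → decidable-stable (P? x) λ ¬px → ¬∃ (x , ¬px)

module _ {q : ℕ} (F : FiniteField q) where
  private
    module F = FiniteField F
    module ΣF = Sum F.+-commutativeMonoid

  Matrix : ℕ → ℕ → Set
  Matrix ℓ m = Vec (Vec F.Carrier m) ℓ

  rowCombination : ∀ {k m} → Vec F.Carrier k → Matrix k m → Vec F.Carrier m
  rowCombination c B =
    tabulate λ j → ΣF.sum λ i → lookup c i F.* lookup (lookup B i) j

  InRowSpace : ∀ {k m} → Matrix k m → Vec F.Carrier m → Set
  InRowSpace B v = ∃[ c ] rowCombination c B ≡ v

  IndependentRows : ∀ {k m} → Matrix k m → Set
  IndependentRows {k} {m} B =
    ∀ c → rowCombination c B ≡ replicate m F.0# → c ≡ replicate k F.0#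

  -- rk M = t: the row space of M has a basis of t vectors (the rows of B).
  HasRank : ∀ {ℓ m} → Matrix ℓ m → ℕ → Set
  HasRank {ℓ} {m} M t =
    Σ[ B ∈ Matrix t m ] IndependentRows B × (∀ v → InRowSpace B v ⇔ InRowSpace M v)

  partialTrace : ∀ {ℓ m} r → .(r ≤ ℓ) → .(ℓ ≤ m) → Matrix ℓ m → F.Carrier
  partialTrace r r≤ℓ ℓ≤m M =
    ΣF.sum λ (i : Fin r) →
      lookup (lookup M (inject≤ i r≤ℓ)) (inject≤ i (ℕ.≤-trans r≤ℓ ℓ≤m))

  elements-complete : ∀ x → x ∈ F.elements
  elements-complete x =
    subst (_∈ F.elements) (Inverse.strictlyInverseˡ F.enumeration x)
          (∈-map⁺ (Inverse.to F.enumeration) (∈-allFin (Inverse.from F.enumeration x)))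

  allMatrices : ∀ ℓ m → List (Matrix ℓ m)
  allMatrices ℓ m = allVecs (allVecs F.elements m) ℓ

  private
    vecs-complete : ∀ {n} (v : Vec F.Carrier n) → v ∈ allVecs F.elements n
    vecs-complete = allVecs-complete elements-complete

    _≟ᵛ_ : ∀ {n} → DecidableEquality (Vec F.Carrier n)
    _≟ᵛ_ = Vec.≡-dec F._≟_

  inRowSpace? : ∀ {k m} (B : Matrix k m) → Decidable (InRowSpace B)
  inRowSpace? B v = exists? vecs-complete λ c → rowCombination c B ≟ᵛ v

  independentRows? : ∀ {k m} → Decidable (IndependentRows {k} {m})
  independentRows? B =
    forall? vecs-complete λ c → (rowCombination c B ≟ᵛ _) →-dec (c ≟ᵛ _)

  hasRank? : ∀ {ℓ m} (M : Matrix ℓ m) → Decidable (HasRank M)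
  hasRank? M t =
    exists? (allVecs-complete vecs-complete) λ B →
      independentRows? B ×-dec forall? vecs-complete λ v →
        map′ (λ (f , g) → mk⇔ f g)
             (λ e → Equivalence.to e , Equivalence.from e)
             ((inRowSpace? B v →-dec inRowSpace? M v)
               ×-dec (inRowSpace? M v →-dec inRowSpace? B v))

  count : ∀ {ℓ m} {P : Matrix ℓ m → Set} → Decidable P → ℕ
  count {ℓ} {m} P? = length (filter P? (allMatrices ℓ m))

  μ : (t ℓ m : ℕ) → ℕ
  μ t ℓ m = count {ℓ} {m} λ M → hasRank? M t

  𝔴 : (r t ℓ m : ℕ) → .(r ≤ ℓ) → .(ℓ ≤ m) → ℕ
  𝔴 r t ℓ m r≤ℓ ℓ≤m = count {ℓ} {m} λ M →
    hasRank? M t ×-dec ¬? (partialTrace r r≤ℓ ℓ≤m M F.≟ F.0#)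

-- [ n ]_q! = (q - 1)(q² - 1)⋯(qⁿ - 1), without the usual division by (q - 1)ⁿ.

gaussFactorial : ℕ → ℕ → ℕ
gaussFactorial q zero    = 1
gaussFactorial q (suc n) = (q ℕ.^ suc n ∸ 1) ℕ.* gaussFactorial q n

gaussFactorial-nonZero : ∀ q .{{_ : NonTrivial q}} n → NonZero (gaussFactorial q n)
gaussFactorial-nonZero q zero    = _
gaussFactorial-nonZero q (suc n) =
  ℕ.m*n≢0 (q ℕ.^ suc n ∸ 1) (gaussFactorial q n)
    {{ℕ.>-nonZero (ℕ.m<n⇒0<n∸m (ℕ.<-≤-trans (nonTrivial⇒n>1 q) q≤q^1+n))}}
    {{gaussFactorial-nonZero q n}}
  where
  q≤q^1+n : q ≤ q ℕ.^ suc n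
  q≤q^1+n = ℕ.m≤m*n q (q ℕ.^ n) {{ℕ.m^n≢0 q n {{nonTrivial⇒nonZero q}}}}

fromℕ : ℕ → ℚ
fromℕ n = + n ℚ./ 1

-- [ a ]_q! / [ b ]_q!
gaussFactorialRatio : ∀ q .{{_ : NonTrivial q}} → ℕ → ℕ → ℚ
gaussFactorialRatio q a b =
  ℚ._/_ (+ gaussFactorial q a) (gaussFactorial q b) {{gaussFactorial-nonZero q b}}

gaussBinomial : ∀ q .{{_ : NonTrivial q}} → ℕ → ℤ → ℚ
gaussBinomial q n -[1+ _ ] = 0ℚ
gaussBinomial q n (+ k) with k ℕ.≤? n
... | no  _ = 0ℚ
... | yes _ =
  ℚ._/_ (+ gaussFactorial q n) (gaussFactorial q k ℕ.* gaussFactorial q (n ∸ k))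
    {{ℕ.m*n≢0 (gaussFactorial q k) (gaussFactorial q (n ∸ k))
      {{gaussFactorial-nonZero q k}} {{gaussFactorial-nonZero q (n ∸ k)}}}}

-1^_ : ℕ → ℚ
-1^ s = (ℤ.-1ℤ ℤ.^ s) ℚ./ 1

-- sumFromTo a b f = f a + f (a + 1) + ⋯ + f b, empty if a > b.
sumFromTo : ℕ → ℕ → (ℕ → ℚ) → ℚ
sumFromTo a b f =
  Sum.sum +-0-commutativeMonoid λ (i : Fin (suc b ∸ a)) → f (a ℕ.+ toℕ i)

infix 5 sumFromTo
syntax sumFromTo a b (λ s → e) = ∑[ s from a to b ] e

{-# OPTIONS --safe #-}

-- Let χ(x) = q [x = 0] - 1 and let S be the sum of χ(τ_r(M)) over the matrices M of rank t,
-- so that q 𝔴 = (q - 1) μ - S. Build a matrix row by row: a new row lies in the row space of the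
-- previous rows, which has q^rank elements, or raises the rank by one.
--
-- A row that contributes a diagonal entry to the trace contributes a sum of χ over translates.
-- Since χ sums to 0, only the matrices whose corresponding column vanishes survive; deleting that
-- column gives a two-term recurrence, solved for ℓ = r by (q - 1) (-1)^t q^(t choose 2) [r, t]_q.
-- A row that does not meet the trace gives X(ℓ+1, t+1) = q^(t+1) X(ℓ, t+1) + (q^m - q^t) X(ℓ, t).
-- After multiplication by [m-t]_q! this no longer involves m, and by the q-Pascal rule the
-- functions q^(s(ℓ-r)) q^((t-s) choose 2) [ℓ-r, t-s]_q, s = 0, 1, …, are the solutions whose
-- initial values at ℓ = r are the unit vectors. As μ satisfies the same recurrence, its expansion
-- along the same solutions (a form of the q-Vandermonde identity) comes out of the same argument.

module Submission where

open import Defs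
open import Data.Integer.Base as ℤ using (+_)
open import Data.Nat.Base using (ℕ; NonTrivial; nonTrivial⇒nonZero; _∸_; _^_; _≤_; _<_) renaming (_*_ to _·_)
open import Data.Nat.Combinatorics.Base using (_C_)
open import Data.Product.Base using (_×_)
open import Data.Rational.Base using (0ℚ; _+_; _-_; _*_; _/_)
open import Relation.Binary.PropositionalEquality using (_≡_)

open import Algebra.Bundles using (CommutativeRing)
import Algebra.Properties.CommutativeMonoid.Sum as CommutativeMonoidSum
import Algebra.Properties.Group as GroupProperties
import Algebra.Properties.Ring as RingProperties
import Algebra.Properties.Semiring.Sum as SemiringSum
open import Data.Fin.Base using (Fin; zero; suc; toℕ; inject≤)
import Data.Fin.Properties as Fin
open import Data.Integer.Base using (-[1+_])
import Data.Integer.Properties as ℤ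
open import Data.List.Base as List using (List; []; _∷_; _++_; length; filter; cartesianProductWith)
import Data.List.Properties as List
open import Data.Nat.Base as ℕ using (zero; suc; s≤s; z≤n; NonZero; nonTrivial⇒n>1)
open import Data.Nat.Combinatorics using (nC1≡n; nCk+nC[k+1]≡[n+1]C[k+1])
import Data.Nat.Properties as ℕ
open import Data.Product.Base using (_,_; ∃; ∃-syntax; proj₂)
open import Data.Rational.Base using (ℚ; 1ℚ; -_; 1/_; toℚᵘ; ≢-nonZero)
import Data.Rational.Properties as ℚ
open import Data.Rational.Solver using (module +-*-Solver)
open import Data.Rational.Unnormalised.Base as ℚᵘ using (*≡*)
import Data.Rational.Unnormalised.Properties as ℚᵘ
open import Data.Unit.Base using (tt)
open import Data.Vec.Base as Vec using (Vec; []; _∷_; _∷ʳ_; lookup; replicate; zipWith; map; head; tail)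
import Data.Vec.Properties as Vec
open import Data.Vec.Relation.Unary.All as All using (All; []; _∷_)
open import Function.Base using (_∘_; id)
open import Function.Bundles using (module Injection; module Inverse; _⇔_; mk⇔; module Equivalence)
import Function.Construct.Composition as Composition
open import Function.Definitions using (Injective)
open import Function.Properties.Inverse using (↔⇒↣)
open import Relation.Binary.Definitions using (DecidableEquality; tri<; tri≈; tri>)
open import Relation.Binary.PropositionalEquality
  using (_≢_; refl; sym; trans; cong; cong₂; subst; module ≡-Reasoning)
import Relation.Binary.Reasoning.Setoid as SetoidReasoning
open import Relation.Nullary.Decidable using (Dec; yes; no; map′; _×-dec_; ¬?)
open import Relation.Nullary.Negation using (¬_; contradiction)
open import Relation.Unary using (Decidable)

-- The weight 1, which gives `μ`, and the weight χ differ in the sum over all possible new rows: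
-- `q^m` against 0. So the coefficient `q^m - q^t` of a rank-raising row becomes `-q^t` for a row
-- that meets the trace, and `m` drops out. This matters because such a row also costs a column: its
-- recurrence relates `m + 1` columns to `m`, while rows below the trace keep `m` fixed. The value
-- at ℓ = r does not depend on `m`, so it can serve as initial value for the second recurrence.
--
-- The two kinds of rows enter at opposite ends: a traced row on top, an untraced one at the bottom,
-- where it leaves the trace alone. Hence the rank, computed from the bottom up, has to be
-- independent of the order of the rows. This comes from counting: a row space with a basis of j
-- rows has `q^j` elements.
--
-- Clearing denominators explains the factorials. At ℓ = r the count `μ` times `[m-t]_q!` has the
-- factor `[m]_q!` for every rank, whereas the value for χ is free of `m`, so that `[m-s]_q!` is
-- just the multiplier `[m-t]_q!` at `t = s`. The two agree at `s = 0`, which is why the first sum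
-- of the theorem starts at `s = 1`.

open +-*-Solver using (solve; _:+_; _:*_; _:-_; :-_; _:=_; con)
open SemiringSum (CommutativeRing.semiring ℚ.+-*-commutativeRing)
  using (sum; sum-cong-≗; ∑-distrib-+; *-distribˡ-sum; *-distribʳ-sum)
open ≡-Reasoning

-- Rational numbers

fromℕ-+ : ∀ m n → fromℕ (m ℕ.+ n) ≡ fromℕ m + fromℕ n
fromℕ-+ m n = ℚ.toℚᵘ-injective (begin-≃
  toℚᵘ (fromℕ (m ℕ.+ n))                ≈⟨ ℚ.toℚᵘ-fromℚᵘ (+ (m ℕ.+ n) ℚᵘ./ 1) ⟩
  + (m ℕ.+ n) ℚᵘ./ 1                    ≈⟨ *≡* (cong (ℤ._* (+ 1)) (trans (ℤ.pos-+ m n) (sym (cong₂ ℤ._+_ (ℤ.*-identityʳ (+ m)) (ℤ.*-identityʳ (+ n)))))) ⟩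
  (+ m ℚᵘ./ 1) ℚᵘ.+ (+ n ℚᵘ./ 1)        ≈⟨ ℚᵘ.+-cong (ℚ.toℚᵘ-fromℚᵘ (+ m ℚᵘ./ 1)) (ℚ.toℚᵘ-fromℚᵘ (+ n ℚᵘ./ 1)) ⟨
  toℚᵘ (fromℕ m) ℚᵘ.+ toℚᵘ (fromℕ n)    ≈⟨ ℚ.toℚᵘ-homo-+ (fromℕ m) (fromℕ n) ⟨
  toℚᵘ (fromℕ m + fromℕ n)              ∎-≃)
  where open SetoidReasoning ℚᵘ.≃-setoid renaming (begin_ to begin-≃_; _∎ to _∎-≃)

fromℕ-* : ∀ m n → fromℕ (m ℕ.* n) ≡ fromℕ m * fromℕ n
fromℕ-* m n = ℚ.toℚᵘ-injective (begin-≃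
  toℚᵘ (fromℕ (m ℕ.* n))                ≈⟨ ℚ.toℚᵘ-fromℚᵘ (+ (m ℕ.* n) ℚᵘ./ 1) ⟩
  + (m ℕ.* n) ℚᵘ./ 1                    ≈⟨ *≡* (cong (ℤ._* (+ 1)) (ℤ.pos-* m n)) ⟩
  (+ m ℚᵘ./ 1) ℚᵘ.* (+ n ℚᵘ./ 1)        ≈⟨ ℚᵘ.*-cong (ℚ.toℚᵘ-fromℚᵘ (+ m ℚᵘ./ 1)) (ℚ.toℚᵘ-fromℚᵘ (+ n ℚᵘ./ 1)) ⟨
  toℚᵘ (fromℕ m) ℚᵘ.* toℚᵘ (fromℕ n)    ≈⟨ ℚ.toℚᵘ-homo-* (fromℕ m) (fromℕ n) ⟨
  toℚᵘ (fromℕ m * fromℕ n)              ∎-≃)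
  where open SetoidReasoning ℚᵘ.≃-setoid renaming (begin_ to begin-≃_; _∎ to _∎-≃)

fromℕ-injective : ∀ {m n} → fromℕ m ≡ fromℕ n → m ≡ n
fromℕ-injective {m} {n} eq with ℚ./-injective-≃ (+ m ℚᵘ./ 1) (+ n ℚᵘ./ 1) eq
... | *≡* m*1≡n*1 = ℤ.+-injective (ℤ.*-cancelʳ-≡ (+ m) (+ n) (+ 1) m*1≡n*1)

fromℕ-≢0 : ∀ n .{{_ : NonZero n}} → fromℕ n ≢ 0ℚ
fromℕ-≢0 n eq = ℕ.≢-nonZero⁻¹ n (fromℕ-injective eq)

fromℕ-∸ : ∀ {m n} → n ≤ m → fromℕ (m ∸ n) ≡ fromℕ m - fromℕ n
fromℕ-∸ {m} {n} n≤m = begin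
  fromℕ (m ∸ n)                      ≡⟨ solve 2 (λ x y → x := (x :+ y) :- y) refl _ (fromℕ n) ⟩
  fromℕ (m ∸ n) + fromℕ n - fromℕ n  ≡⟨ cong (_- fromℕ n) (fromℕ-+ (m ∸ n) n) ⟨
  fromℕ (m ∸ n ℕ.+ n) - fromℕ n      ≡⟨ cong (λ x → fromℕ x - fromℕ n) (ℕ.m∸n+n≡m n≤m) ⟩
  fromℕ m - fromℕ n                  ∎

*-cancelʳ-≢0 : ∀ {x y z} → z ≢ 0ℚ → x * z ≡ y * z → x ≡ y
*-cancelʳ-≢0 {x} {y} {z} z≢0 eq = begin
  x                ≡⟨ expand x ⟩
  x * z * (1/ z)   ≡⟨ cong (_* (1/ z)) eq ⟩
  y * z * (1/ z)   ≡⟨ expand y ⟨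
  y                ∎
  where
  instance _ = ≢-nonZero z≢0
  expand : ∀ u → u ≡ u * z * (1/ z)
  expand u = sym (trans (ℚ.*-assoc u z (1/ z)) (trans (cong (u *_) (ℚ.*-inverseʳ z)) (ℚ.*-identityʳ u)))

n/d*d≡n : ∀ n d .{{_ : NonZero d}} → (+ n / d) * fromℕ d ≡ fromℕ n
n/d*d≡n n d@(suc _) = ℚ.toℚᵘ-injective (begin-≃
  toℚᵘ ((+ n / d) * fromℕ d)              ≈⟨ ℚ.toℚᵘ-homo-* (+ n / d) (fromℕ d) ⟩
  toℚᵘ (+ n / d) ℚᵘ.* toℚᵘ (fromℕ d)      ≈⟨ ℚᵘ.*-cong (ℚ.toℚᵘ-fromℚᵘ (+ n ℚᵘ./ d)) (ℚ.toℚᵘ-fromℚᵘ (+ d ℚᵘ./ 1)) ⟩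
  (+ n ℚᵘ./ d) ℚᵘ.* (+ d ℚᵘ./ 1)          ≈⟨ *≡* (trans (ℤ.*-identityʳ (+ n ℤ.* + d)) (cong (λ e → + n ℤ.* + e) (sym (ℕ.*-identityʳ d)))) ⟩
  + n ℚᵘ./ 1                              ≈⟨ ℚ.toℚᵘ-fromℚᵘ (+ n ℚᵘ./ 1) ⟨
  toℚᵘ (fromℕ n)                          ∎-≃)
  where open SetoidReasoning ℚᵘ.≃-setoid renaming (begin_ to begin-≃_; _∎ to _∎-≃)

/-unique : ∀ {x} n d .{{_ : NonZero d}} → x * fromℕ d ≡ fromℕ n → + n / d ≡ x
/-unique n d eq = *-cancelʳ-≢0 (fromℕ-≢0 d) (trans (n/d*d≡n n d) (sym eq))

-- Gaussian binomials and the rank recurrence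

-1^-suc : ∀ s → -1^ suc s ≡ - (-1^ s)
-1^-suc s = trans (cong (_/ 1) (ℤ.-1*i≡-i (ℤ.-1ℤ ℤ.^ s))) (neg/1 (ℤ.-1ℤ ℤ.^ s))
  where
  neg/1 : ∀ i → (ℤ.- i) / 1 ≡ - (i / 1)
  neg/1 (+ zero)  = refl
  neg/1 (+ suc n) = refl
  neg/1 -[1+ n ]  = sym (⁻¹-involutive _)
    where open GroupProperties ℚ.+-0-group using (⁻¹-involutive)

module QAlgebra (q : ℕ) .{{q-nonTrivial : NonTrivial q}} where

  Q : ℕ → ℚ
  Q n = fromℕ (q ^ n)

  Q-+ : ∀ m n → Q (m ℕ.+ n) ≡ Q m * Q n
  Q-+ m n = trans (cong fromℕ (ℕ.^-distribˡ-+-* q m n)) (fromℕ-* (q ^ m) (q ^ n))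

  Q-suc : ∀ n → Q (suc n) ≡ Q 1 * Q n
  Q-suc = Q-+ 1

  Q-C2-suc : ∀ t → Q (suc t C 2) ≡ Q t * Q (t C 2)
  Q-C2-suc t = begin
    Q (suc t C 2)          ≡⟨ cong Q (nCk+nC[k+1]≡[n+1]C[k+1] t 1) ⟨
    Q (t C 1 ℕ.+ t C 2)    ≡⟨ cong (λ e → Q (e ℕ.+ t C 2)) (nC1≡n t) ⟩
    Q (t ℕ.+ t C 2)        ≡⟨ Q-+ t (t C 2) ⟩
    Q t * Q (t C 2)        ∎

  G : ℕ → ℚ
  G n = fromℕ (gaussFactorial q n)

  G-≢0 : ∀ n → G n ≢ 0ℚ
  G-≢0 n = fromℕ-≢0 (gaussFactorial q n) {{gaussFactorial-nonZero q n}}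

  G-suc : ∀ n → G (suc n) ≡ (Q (suc n) - 1ℚ) * G n
  G-suc n = trans (fromℕ-* (q ^ suc n ∸ 1) (gaussFactorial q n))
                  (cong (_* G n) (fromℕ-∸ (ℕ.m^n>0 q {{nonTrivial⇒nonZero q}} (suc n))))

  ratio-* : ∀ a b → gaussFactorialRatio q a b * G b ≡ G a
  ratio-* a b = n/d*d≡n (gaussFactorial q a) (gaussFactorial q b) {{gaussFactorial-nonZero q b}}

  -- The Gaussian binomial without quotients. Of the two q-Pascal rules, this is the one whose
  -- coefficient `q^(k+1)` agrees with the `q^(t+1)` of the rank recurrences.
  binomial : ℕ → ℕ → ℚ
  binomial _       zero    = 1ℚ
  binomial zero    (suc k) = 0ℚ
  binomial (suc n) (suc k) = Q (suc k) * binomial n (suc k) + binomial n k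

  binomial-> : ∀ {n k} → n < k → binomial n k ≡ 0ℚ
  binomial-> {zero}  {suc k} _         = refl
  binomial-> {suc n} {suc k} (s≤s n<k)
    rewrite binomial-> n<k | binomial-> (ℕ.m<n⇒m<1+n n<k) | ℚ.*-zeroʳ (Q (suc k)) = refl

  binomial-diag : ∀ n → binomial n n ≡ 1ℚ
  binomial-diag zero    = refl
  binomial-diag (suc n)
    rewrite binomial-> (ℕ.n<1+n n) | binomial-diag n | ℚ.*-zeroʳ (Q (suc n)) = refl

  -- `q^(k+j+2) - 1` splits as `q^(k+1) (q^(j+1) - 1) + (q^(k+1) - 1)`, and the two parts match the
  -- two terms of the q-Pascal rule. Writing `n = k + j` keeps truncated subtraction out of the
  -- induction.
  binomial-factorials : ∀ k j → binomial (k ℕ.+ j) k * (G k * G j) ≡ G (k ℕ.+ j)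
  binomial-factorials zero    j    = trans (ℚ.*-identityˡ (1ℚ * G j)) (ℚ.*-identityˡ (G j))
  binomial-factorials (suc k) zero
    rewrite ℕ.+-identityʳ k | binomial-diag (suc k) = trans (ℚ.*-identityˡ (G (suc k) * 1ℚ)) (ℚ.*-identityʳ (G (suc k)))
  binomial-factorials (suc k) (suc j) = begin
    (Q (suc k) * b₁ + b₂) * (G (suc k) * G (suc j))
      ≡⟨ solve 5 (λ x b₁ b₂ g h → (x :* b₁ :+ b₂) :* (g :* h) := x :* b₁ :* g :* h :+ b₂ :* g :* h)
           refl (Q (suc k)) b₁ b₂ (G (suc k)) (G (suc j)) ⟩
    Q (suc k) * b₁ * G (suc k) * G (suc j) + b₂ * G (suc k) * G (suc j)
      ≡⟨ cong₂ (λ u v → Q (suc k) * b₁ * G (suc k) * u + b₂ * v * G (suc j)) (G-suc j) (G-suc k) ⟩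
    Q (suc k) * b₁ * G (suc k) * ((Q (suc j) - 1ℚ) * G j) + b₂ * ((Q (suc k) - 1ℚ) * G k) * G (suc j)
      ≡⟨ solve 8 (λ x y b₁ b₂ g g′ h h′ →
             x :* b₁ :* g′ :* ((y :- con 1ℚ) :* h) :+ b₂ :* ((x :- con 1ℚ) :* g) :* h′
               := x :* (y :- con 1ℚ) :* (b₁ :* (g′ :* h)) :+ (x :- con 1ℚ) :* (b₂ :* (g :* h′)))
           refl (Q (suc k)) (Q (suc j)) b₁ b₂ (G k) (G (suc k)) (G j) (G (suc j)) ⟩
    Q (suc k) * (Q (suc j) - 1ℚ) * (b₁ * (G (suc k) * G j)) + (Q (suc k) - 1ℚ) * (b₂ * (G k * G (suc j)))
      ≡⟨ cong₂ (λ u v → Q (suc k) * (Q (suc j) - 1ℚ) * u + (Q (suc k) - 1ℚ) * v)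
           (subst (λ n → binomial n (suc k) * (G (suc k) * G j) ≡ G n) (sym (ℕ.+-suc k j)) (binomial-factorials (suc k) j))
           (binomial-factorials k (suc j)) ⟩
    Q (suc k) * (Q (suc j) - 1ℚ) * G (k ℕ.+ suc j) + (Q (suc k) - 1ℚ) * G (k ℕ.+ suc j)
      ≡⟨ solve 3 (λ x y g → x :* (y :- con 1ℚ) :* g :+ (x :- con 1ℚ) :* g := (x :* y :- con 1ℚ) :* g)
           refl (Q (suc k)) (Q (suc j)) (G (k ℕ.+ suc j)) ⟩
    (Q (suc k) * Q (suc j) - 1ℚ) * G (k ℕ.+ suc j)
      ≡⟨ cong (λ u → (u - 1ℚ) * G (k ℕ.+ suc j)) (Q-+ (suc k) (suc j)) ⟨
    (Q (suc k ℕ.+ suc j) - 1ℚ) * G (k ℕ.+ suc j)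
      ≡⟨ G-suc (k ℕ.+ suc j) ⟨
    G (suc k ℕ.+ suc j) ∎
    where
    b₁ = binomial (k ℕ.+ suc j) (suc k)
    b₂ = binomial (k ℕ.+ suc j) k

  gaussBinomial≡binomial : ∀ n k → gaussBinomial q n (+ k) ≡ binomial n k
  gaussBinomial≡binomial n k with k ℕ.≤? n
  ... | no  k≰n = sym (binomial-> (ℕ.≰⇒> k≰n))
  ... | yes k≤n = /-unique (gaussFactorial q n) (gaussFactorial q k ℕ.* gaussFactorial q (n ∸ k))
      {{ℕ.m*n≢0 _ _ {{gaussFactorial-nonZero q k}} {{gaussFactorial-nonZero q (n ∸ k)}}}} (begin
    binomial n k * fromℕ (gaussFactorial q k ℕ.* gaussFactorial q (n ∸ k))
      ≡⟨ cong (binomial n k *_) (fromℕ-* (gaussFactorial q k) (gaussFactorial q (n ∸ k))) ⟩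
    binomial n k * (G k * G (n ∸ k))
      ≡⟨ subst (λ n′ → binomial n′ k * (G k * G (n ∸ k)) ≡ G n′) (ℕ.m+[n∸m]≡n k≤n) (binomial-factorials k (n ∸ k)) ⟩
    G n ∎)

  -- [ k , t - s ]_q; for s > t truncated subtraction would give [ k , 0 ]_q = 1 instead of 0.
  shiftedBinomial : ℕ → ℕ → ℕ → ℚ
  shiftedBinomial k t       zero    = binomial k t
  shiftedBinomial k zero    (suc s) = 0ℚ
  shiftedBinomial k (suc t) (suc s) = shiftedBinomial k t s

  gaussBinomial-vanishes : ∀ k t s → t < s → gaussBinomial q k (+ t ℤ.- + s) ≡ 0ℚ
  gaussBinomial-vanishes k t s t<s rewrite ℤ.m-n≡m⊖n t s | ℤ.⊖-< t<s with s ∸ t | ℕ.m<n⇒0<n∸m t<s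
  ... | suc _ | _ = refl

  gaussBinomial≡shiftedBinomial : ∀ k t s → gaussBinomial q k (+ t ℤ.- + s) ≡ shiftedBinomial k t s
  gaussBinomial≡shiftedBinomial k t       zero    =
    trans (cong (gaussBinomial q k) (ℤ.+-identityʳ (+ t))) (gaussBinomial≡binomial k t)
  gaussBinomial≡shiftedBinomial k zero    (suc s) = refl
  gaussBinomial≡shiftedBinomial k (suc t) (suc s) = begin
    gaussBinomial q k (+ suc t ℤ.- + suc s)   ≡⟨ cong (gaussBinomial q k) (trans (ℤ.m-n≡m⊖n (suc t) (suc s)) (ℤ.[1+m]⊖[1+n]≡m⊖n t s)) ⟩
    gaussBinomial q k (t ℤ.⊖ s)               ≡⟨ cong (gaussBinomial q k) (ℤ.m-n≡m⊖n t s) ⟨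
    gaussBinomial q k (+ t ℤ.- + s)           ≡⟨ gaussBinomial≡shiftedBinomial k t s ⟩
    shiftedBinomial k t s                     ∎

  -- Here `k = ℓ - r` is the number of rows below the trace. Of the s-th summand, this is the part
  -- that changes with `k`; `[r, s]_q` and the factorials act as constant coefficients.
  kernel : ℕ → ℕ → ℕ → ℚ
  kernel k t s = Q (s ℕ.* k) * (Q ((t ∸ s) C 2) * shiftedBinomial k t s)

  -- For `s = 0` this is the q-Pascal rule. Passing from `(t, s)` to `(t+1, s+1)` leaves `t - s`
  -- unchanged and multiplies each of `q^s`, `q^(t+1)`, `q^t` by `q`, so the induction runs along
  -- diagonals. The outer `q^s` is what `q^(s(k+1))` retains after division by `q^(sk)`.
  shiftedBinomial-suc : ∀ k t s →
    Q s * (Q ((suc t ∸ s) C 2) * shiftedBinomial (suc k) (suc t) s)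
      ≡ Q (suc t) * (Q ((suc t ∸ s) C 2) * shiftedBinomial k (suc t) s)
        + Q t * (Q ((t ∸ s) C 2) * shiftedBinomial k t s)
  shiftedBinomial-suc k t zero rewrite Q-C2-suc t =
    solve 5 (λ x y z b b′ → con 1ℚ :* (y :* z :* (x :* b :+ b′)) := x :* (y :* z :* b) :+ y :* (z :* b′))
      refl (Q (suc t)) (Q t) (Q (t C 2)) (binomial k (suc t)) (binomial k t)
  -- Here `s = t + 1`: the first two binomials have lower index 0 and equal 1, and the third
  -- vanishes because `s > t`.
  shiftedBinomial-suc k zero (suc zero) =
    solve 2 (λ x z → x :* (z :* con 1ℚ) := x :* (z :* con 1ℚ) :+ con 1ℚ :* (z :* con 0ℚ)) refl (Q 1) (Q 0)
  shiftedBinomial-suc k zero (suc (suc s)) =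
    solve 3 (λ x y z → y :* (z :* con 0ℚ) := x :* (z :* con 0ℚ) :+ con 1ℚ :* (z :* con 0ℚ)) refl (Q 1) (Q (suc (suc s))) (Q 0)
  shiftedBinomial-suc k (suc t) (suc s) = begin
    Q (suc s) * u             ≡⟨ cong (_* u) (Q-suc s) ⟩
    Q 1 * Q s * u             ≡⟨ ℚ.*-assoc (Q 1) (Q s) u ⟩
    Q 1 * (Q s * u)           ≡⟨ cong (Q 1 *_) (shiftedBinomial-suc k t s) ⟩
    Q 1 * (Q (suc t) * v + Q t * w)
      ≡⟨ solve 5 (λ x y z v w → x :* (y :* v :+ z :* w) := x :* y :* v :+ x :* z :* w) refl (Q 1) (Q (suc t)) (Q t) v w ⟩
    Q 1 * Q (suc t) * v + Q 1 * Q t * w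
      ≡⟨ cong₂ (λ a b → a * v + b * w) (Q-suc (suc t)) (Q-suc t) ⟨
    Q (suc (suc t)) * v + Q (suc t) * w ∎
    where
    u = Q ((suc t ∸ s) C 2) * shiftedBinomial (suc k) (suc t) s
    v = Q ((suc t ∸ s) C 2) * shiftedBinomial k (suc t) s
    w = Q ((t ∸ s) C 2) * shiftedBinomial k t s

  kernel-suc : ∀ k t s → kernel (suc k) (suc t) s ≡ Q (suc t) * kernel k (suc t) s + Q t * kernel k t s
  kernel-suc k t s = begin
    Q (s ℕ.* suc k) * u           ≡⟨ cong (_* u) (trans (cong Q (ℕ.*-suc s k)) (Q-+ s (s ℕ.* k))) ⟩
    Q s * Q (s ℕ.* k) * u         ≡⟨ solve 3 (λ x y u → x :* y :* u := y :* (x :* u)) refl (Q s) (Q (s ℕ.* k)) u ⟩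
    Q (s ℕ.* k) * (Q s * u)       ≡⟨ cong (Q (s ℕ.* k) *_) (shiftedBinomial-suc k t s) ⟩
    Q (s ℕ.* k) * (Q (suc t) * v + Q t * w)
      ≡⟨ solve 5 (λ x y z v w → x :* (y :* v :+ z :* w) := y :* (x :* v) :+ z :* (x :* w)) refl (Q (s ℕ.* k)) (Q (suc t)) (Q t) v w ⟩
    Q (suc t) * kernel k (suc t) s + Q t * kernel k t s ∎
    where
    u = Q ((suc t ∸ s) C 2) * shiftedBinomial (suc k) (suc t) s
    v = Q ((suc t ∸ s) C 2) * shiftedBinomial k (suc t) s
    w = Q ((t ∸ s) C 2) * shiftedBinomial k t s

  kernel-suc-0 : ∀ k s → kernel (suc k) 0 s ≡ kernel k 0 s
  kernel-suc-0 k zero    = refl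
  kernel-suc-0 k (suc s) = trans (vanish (suc k)) (sym (vanish k))
    where
    vanish : ∀ k → kernel k 0 (suc s) ≡ 0ℚ
    vanish k = ℚ.*-zeroʳ (Q (suc s ℕ.* k))

  -- `shiftedBinomial 0 t s` is the Kronecker delta of `t` and `s`; where it is nonzero the exponent
  -- is `0 C 2 = 0`, so the power of `q` disappears.
  kernel-0 : ∀ t s → kernel 0 t s ≡ shiftedBinomial 0 t s
  kernel-0 t s rewrite ℕ.*-zeroʳ s = trans (ℚ.*-identityˡ (Q ((t ∸ s) C 2) * shiftedBinomial 0 t s)) (go t s)
    where
    go : ∀ t s → Q ((t ∸ s) C 2) * shiftedBinomial 0 t s ≡ shiftedBinomial 0 t s
    go zero    zero    = refl
    go (suc t) zero    = ℚ.*-zeroʳ (Q (suc t C 2))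
    go zero    (suc s) = refl
    go (suc t) (suc s) = go t s

  -- Summation against a Kronecker delta. The hypothesis deals with a `t` beyond the range of
  -- summation, where the sum has no nonzero term.
  sum-shiftedBinomial-0 : ∀ n (a : ℕ → ℚ) t → (n ≤ t → a t ≡ 0ℚ) →
    sum (λ (i : Fin n) → a (toℕ i) * shiftedBinomial 0 t (toℕ i)) ≡ a t
  sum-shiftedBinomial-0 zero    a t       vanish = sym (vanish z≤n)
  sum-shiftedBinomial-0 (suc n) a zero    vanish = begin
    a 0 * 1ℚ + sum (λ (i : Fin n) → a (suc (toℕ i)) * 0ℚ)
      ≡⟨ cong (λ e → a 0 * 1ℚ + e) (*-distribʳ-sum 0ℚ (λ (i : Fin n) → a (suc (toℕ i)))) ⟨
    a 0 * 1ℚ + sum (λ (i : Fin n) → a (suc (toℕ i))) * 0ℚ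
      ≡⟨ solve 2 (λ x y → x :* con 1ℚ :+ y :* con 0ℚ := x) refl (a 0) (sum (λ (i : Fin n) → a (suc (toℕ i)))) ⟩
    a 0 ∎
  sum-shiftedBinomial-0 (suc n) a (suc t) vanish = begin
    a 0 * 0ℚ + sum (λ (i : Fin n) → a (suc (toℕ i)) * shiftedBinomial 0 t (toℕ i))
      ≡⟨ cong₂ _+_ (ℚ.*-zeroʳ (a 0)) (sum-shiftedBinomial-0 n (a ∘ suc) t (vanish ∘ s≤s)) ⟩
    0ℚ + a (suc t)
      ≡⟨ ℚ.+-identityˡ (a (suc t)) ⟩
    a (suc t) ∎

  -- `k` is the number of rows added so far and `t` the rank; the values at `k = 0` stay free. Rank
  -- 0 has its own clause: it arises only from rank 0, and only by adding the zero row.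
  RankRecurrence : ℕ → (ℕ → ℕ → ℚ) → Set
  RankRecurrence m X =
    (∀ k → X (suc k) 0 ≡ X k 0) ×
    (∀ k t → X (suc k) (suc t) ≡ Q (suc t) * X k (suc t) + (Q m - Q t) * X k t)

  -- Multiplying by [m-t]! turns the coefficient q^m - q^t into q^t, which no longer involves m.
  rankRecurrence-solution : ∀ {m X} r (a : ℕ → ℚ) → RankRecurrence m X →
    (∀ t → t ≤ m → X 0 t * G (m ∸ t) ≡ a t) →
    (∀ t → r < t → a t ≡ 0ℚ) →
    ∀ k t → t ≤ m → X k t * G (m ∸ t) ≡ ∑[ s from 0 to r ] a s * kernel k t s
  rankRecurrence-solution {m} {X} r a (X-0 , X-suc) X₀ vanish = go
    where
    go : ∀ k t → t ≤ m → X k t * G (m ∸ t) ≡ sum (λ (i : Fin (suc r)) → a (toℕ i) * kernel k t (toℕ i))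
    go zero t t≤m = begin
      X 0 t * G (m ∸ t)  ≡⟨ X₀ t t≤m ⟩
      a t                ≡⟨ sum-shiftedBinomial-0 (suc r) a t (vanish t) ⟨
      sum (λ (i : Fin (suc r)) → a (toℕ i) * shiftedBinomial 0 t (toℕ i))
        ≡⟨ sum-cong-≗ {suc r} (λ i → cong (a (toℕ i) *_) (kernel-0 t (toℕ i))) ⟨
      sum (λ (i : Fin (suc r)) → a (toℕ i) * kernel 0 t (toℕ i)) ∎
    go (suc k) zero t≤m = begin
      X (suc k) 0 * G m  ≡⟨ cong (_* G m) (X-0 k) ⟩
      X k 0 * G m        ≡⟨ go k zero t≤m ⟩
      sum (λ (i : Fin (suc r)) → a (toℕ i) * kernel k 0 (toℕ i))
        ≡⟨ sum-cong-≗ {suc r} (λ i → cong (a (toℕ i) *_) (kernel-suc-0 k (toℕ i))) ⟨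
      sum (λ (i : Fin (suc r)) → a (toℕ i) * kernel (suc k) 0 (toℕ i)) ∎
    go (suc k) (suc t) t<m = begin
      X (suc k) (suc t) * g
        ≡⟨ cong (_* g) (X-suc k t) ⟩
      (Q (suc t) * X k (suc t) + (Q m - Q t) * X k t) * g
        ≡⟨ solve 6 (λ x y z u v g → (x :* u :+ (y :- z) :* v) :* g := x :* (u :* g) :+ (y :- z) :* g :* v)
             refl (Q (suc t)) (Q m) (Q t) (X k (suc t)) (X k t) g ⟩
      Q (suc t) * (X k (suc t) * g) + (Q m - Q t) * g * X k t
        ≡⟨ cong (λ u → Q (suc t) * (X k (suc t) * g) + u * X k t) factor ⟩
      Q (suc t) * (X k (suc t) * g) + Q t * G (m ∸ t) * X k t
        ≡⟨ cong (λ u → Q (suc t) * (X k (suc t) * g) + u)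
             (solve 3 (λ x y z → x :* y :* z := x :* (z :* y)) refl (Q t) (G (m ∸ t)) (X k t)) ⟩
      Q (suc t) * (X k (suc t) * g) + Q t * (X k t * G (m ∸ t))
        ≡⟨ cong₂ (λ u v → Q (suc t) * u + Q t * v) (go k (suc t) t<m) (go k t (ℕ.<⇒≤ t<m)) ⟩
      Q (suc t) * sum f₁ + Q t * sum f₀
        ≡⟨ cong₂ _+_ (*-distribˡ-sum (Q (suc t)) f₁) (*-distribˡ-sum (Q t) f₀) ⟩
      sum (λ i → Q (suc t) * f₁ i) + sum (λ i → Q t * f₀ i)
        ≡⟨ ∑-distrib-+ (λ i → Q (suc t) * f₁ i) (λ i → Q t * f₀ i) ⟨
      sum (λ i → Q (suc t) * f₁ i + Q t * f₀ i)
        ≡⟨ sum-cong-≗ {suc r} (λ i → trans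
             (solve 5 (λ x y a u v → x :* (a :* u) :+ y :* (a :* v) := a :* (x :* u :+ y :* v))
               refl (Q (suc t)) (Q t) (a (toℕ i)) (kernel k (suc t) (toℕ i)) (kernel k t (toℕ i)))
             (cong (a (toℕ i) *_) (sym (kernel-suc k t (toℕ i))))) ⟩
      sum (λ (i : Fin (suc r)) → a (toℕ i) * kernel (suc k) (suc t) (toℕ i)) ∎
      where
      g = G (m ∸ suc t)
      f₁ f₀ : Fin (suc r) → ℚ
      f₁ i = a (toℕ i) * kernel k (suc t) (toℕ i)
      f₀ i = a (toℕ i) * kernel k t (toℕ i)
      m∸t : m ∸ t ≡ suc (m ∸ suc t)
      m∸t = ℕ.+-∸-assoc 1 t<m
      -- `q^m - q^t = q^t (q^(m-t) - 1)`, and the bracket is the factor that takes `g = [m-t-1]_q!`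
      -- to `[m-t]_q!`.
      factor : (Q m - Q t) * g ≡ Q t * G (m ∸ t)
      factor = begin
        (Q m - Q t) * g
          ≡⟨ cong (λ e → (Q e - Q t) * g) (ℕ.m+[n∸m]≡n (ℕ.<⇒≤ t<m)) ⟨
        (Q (t ℕ.+ (m ∸ t)) - Q t) * g
          ≡⟨ cong (λ u → (u - Q t) * g) (Q-+ t (m ∸ t)) ⟩
        (Q t * Q (m ∸ t) - Q t) * g
          ≡⟨ solve 3 (λ x y g → (x :* y :- x) :* g := x :* ((y :- con 1ℚ) :* g)) refl (Q t) (Q (m ∸ t)) g ⟩
        Q t * ((Q (m ∸ t) - 1ℚ) * g)
          ≡⟨ cong (Q t *_) (subst (λ e → (Q e - 1ℚ) * g ≡ G e) (sym m∸t) (sym (G-suc (m ∸ suc t)))) ⟩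
        Q t * G (m ∸ t) ∎

-- Weighted sums over lists

private variable
  A B D P R : Set

𝟙 : Dec P → ℚ
𝟙 (yes _) = 1ℚ
𝟙 (no  _) = 0ℚ

𝟙-true : (p? : Dec P) → P → 𝟙 p? ≡ 1ℚ
𝟙-true (yes _) _ = refl
𝟙-true (no ¬p) p = contradiction p ¬p

𝟙-false : (p? : Dec P) → ¬ P → 𝟙 p? ≡ 0ℚ
𝟙-false (yes p) ¬p = contradiction p ¬p
𝟙-false (no _)  _  = refl

𝟙-cong : (p? : Dec P) (r? : Dec R) → (P → R) → (R → P) → 𝟙 p? ≡ 𝟙 r?
𝟙-cong (yes p) r? f g = sym (𝟙-true r? (f p))
𝟙-cong (no ¬p) r? f g = sym (𝟙-false r? (¬p ∘ g))

𝟙-× : (p? : Dec P) (r? : Dec R) → 𝟙 (p? ×-dec r?) ≡ 𝟙 p? * 𝟙 r?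
𝟙-× (yes _) (yes _) = refl
𝟙-× (yes _) (no _)  = refl
𝟙-× (no _)  (yes _) = refl
𝟙-× (no _)  (no _)  = refl

𝟙-¬ : (p? : Dec P) → 𝟙 (¬? p?) ≡ 1ℚ - 𝟙 p?
𝟙-¬ (yes _) = refl
𝟙-¬ (no _)  = refl

sumOver : List A → (A → ℚ) → ℚ
sumOver []       f = 0ℚ
sumOver (x ∷ xs) f = f x + sumOver xs f

infix 5 sumOver
syntax sumOver xs (λ x → e) = Σ[ x ← xs ] e

sumOver-cong : ∀ (xs : List A) {f g : A → ℚ} → (∀ x → f x ≡ g x) → sumOver xs f ≡ sumOver xs g
sumOver-cong []       f≗g = refl
sumOver-cong (x ∷ xs) f≗g = cong₂ _+_ (f≗g x) (sumOver-cong xs f≗g)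

sumOver-0 : (xs : List A) → (Σ[ x ← xs ] 0ℚ) ≡ 0ℚ
sumOver-0 []       = refl
sumOver-0 (x ∷ xs) = trans (ℚ.+-identityˡ _) (sumOver-0 xs)

sumOver-+ : ∀ (xs : List A) f g → (Σ[ x ← xs ] (f x + g x)) ≡ sumOver xs f + sumOver xs g
sumOver-+ []       f g = refl
sumOver-+ (x ∷ xs) f g = trans (cong₂ _+_ {x = f x + g x} refl (sumOver-+ xs f g))
  (solve 4 (λ a b c d → a :+ b :+ (c :+ d) := a :+ c :+ (b :+ d)) refl (f x) (g x) (sumOver xs f) (sumOver xs g))

sumOver-*ˡ : ∀ (xs : List A) c f → (Σ[ x ← xs ] c * f x) ≡ c * sumOver xs f
sumOver-*ˡ []       c f = sym (ℚ.*-zeroʳ c)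
sumOver-*ˡ (x ∷ xs) c f = trans (cong₂ _+_ {x = c * f x} refl (sumOver-*ˡ xs c f)) (sym (ℚ.*-distribˡ-+ c (f x) (sumOver xs f)))

sumOver-*ʳ : ∀ (xs : List A) c f → (Σ[ x ← xs ] f x * c) ≡ sumOver xs f * c
sumOver-*ʳ xs c f = trans (sumOver-cong xs (λ x → ℚ.*-comm (f x) c)) (trans (sumOver-*ˡ xs c f) (ℚ.*-comm c _))

sumOver-linear : ∀ (xs : List A) c d f g →
  (Σ[ x ← xs ] (c * f x + d * g x)) ≡ c * sumOver xs f + d * sumOver xs g
sumOver-linear xs c d f g = trans (sumOver-+ xs (λ x → c * f x) (λ x → d * g x)) (cong₂ _+_ (sumOver-*ˡ xs c f) (sumOver-*ˡ xs d g))

sumOver-swap : ∀ (xs : List A) (ys : List B) (f : A → B → ℚ) →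
  (Σ[ x ← xs ] Σ[ y ← ys ] f x y) ≡ (Σ[ y ← ys ] Σ[ x ← xs ] f x y)
sumOver-swap []       ys f = sym (sumOver-0 ys)
sumOver-swap (x ∷ xs) ys f = trans (cong₂ _+_ {x = sumOver ys (f x)} refl (sumOver-swap xs ys f))
  (sym (sumOver-+ ys (f x) (λ y → Σ[ x ← xs ] f x y)))

sumOver-++ : ∀ (xs ys : List A) f → sumOver (xs ++ ys) f ≡ sumOver xs f + sumOver ys f
sumOver-++ []       ys f = sym (ℚ.+-identityˡ (sumOver ys f))
sumOver-++ (x ∷ xs) ys f = trans (cong₂ _+_ {x = f x} refl (sumOver-++ xs ys f)) (sym (ℚ.+-assoc (f x) _ _))

sumOver-map : ∀ (h : A → B) xs f → sumOver (List.map h xs) f ≡ sumOver xs (f ∘ h)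
sumOver-map h []       f = refl
sumOver-map h (x ∷ xs) f = cong₂ _+_ {x = f (h x)} refl (sumOver-map h xs f)

sumOver-cartesianProductWith : ∀ (h : A → B → D) xs ys f →
  sumOver (cartesianProductWith h xs ys) f ≡ (Σ[ x ← xs ] Σ[ y ← ys ] f (h x y))
sumOver-cartesianProductWith h []       ys f = refl
sumOver-cartesianProductWith h (x ∷ xs) ys f = trans (sumOver-++ (List.map (h x) ys) _ f)
  (cong₂ _+_ (sumOver-map (h x) ys f) (sumOver-cartesianProductWith h xs ys f))

sumOver-allVecs-suc : ∀ (xs : List A) n f →
  sumOver (allVecs xs (suc n)) f ≡ (Σ[ x ← xs ] Σ[ v ← allVecs xs n ] f (x ∷ v))
sumOver-allVecs-suc xs n f = sumOver-cartesianProductWith _∷_ xs (allVecs xs n) f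

-- `allVecs` splits off the first entry. Splitting off the last one instead makes it possible to
-- vary the bottom row of a matrix with the rows above it fixed.
sumOver-allVecs-∷ʳ : ∀ (xs : List A) n f →
  sumOver (allVecs xs (suc n)) f ≡ (Σ[ v ← allVecs xs n ] Σ[ x ← xs ] f (v ∷ʳ x))
sumOver-allVecs-∷ʳ xs zero    f = trans (sumOver-allVecs-suc xs zero f)
  (trans (sumOver-cong xs (λ x → ℚ.+-identityʳ (f (x ∷ [])))) (sym (ℚ.+-identityʳ _)))
sumOver-allVecs-∷ʳ xs (suc n) f = begin
  sumOver (allVecs xs (suc (suc n))) f
    ≡⟨ sumOver-allVecs-suc xs (suc n) f ⟩
  (Σ[ x ← xs ] Σ[ v ← allVecs xs (suc n) ] f (x ∷ v))
    ≡⟨ sumOver-cong xs (λ x → sumOver-allVecs-∷ʳ xs n (λ v → f (x ∷ v))) ⟩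
  (Σ[ x ← xs ] Σ[ v ← allVecs xs n ] Σ[ y ← xs ] f (x ∷ (v ∷ʳ y)))
    ≡⟨ sumOver-allVecs-suc xs n (λ v → Σ[ y ← xs ] f (v ∷ʳ y)) ⟨
  (Σ[ v ← allVecs xs (suc n) ] Σ[ y ← xs ] f (v ∷ʳ y)) ∎

length-filter : ∀ {P : A → Set} (P? : Decidable P) xs →
  fromℕ (length (filter P? xs)) ≡ (Σ[ x ← xs ] 𝟙 (P? x))
length-filter P? []       = refl
length-filter P? (x ∷ xs) with P? x
... | yes _ = trans (fromℕ-+ 1 (length (filter P? xs))) (cong₂ _+_ {x = 1ℚ} refl (length-filter P? xs))
... | no _  = trans (length-filter P? xs) (sym (ℚ.+-identityˡ _))

-- Every element is listed exactly once, expressed as the sifting property of the Kronecker delta: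
-- this is the form in which sums consume it.
record Enumerates {A : Set} (_≟_ : DecidableEquality A) (xs : List A) : Set where
  field
    pick : ∀ (a : A) (g : A → ℚ) → (Σ[ x ← xs ] 𝟙 (x ≟ a) * g x) ≡ g a

  pick-1 : ∀ a → (Σ[ x ← xs ] 𝟙 (x ≟ a)) ≡ 1ℚ
  pick-1 a = trans (sumOver-cong xs (λ x → sym (ℚ.*-identityʳ (𝟙 (x ≟ a))))) (pick a (λ _ → 1ℚ))

open Enumerates

enumerates-allVecs : ∀ {A : Set} {_≟_ : DecidableEquality A} {xs} → Enumerates _≟_ xs →
  ∀ {n} → Enumerates (Vec.≡-dec _≟_) (allVecs xs n)
pick (enumerates-allVecs {_≟_ = _≟_} {xs} en {zero}) [] g = trans (ℚ.+-identityʳ _) (ℚ.*-identityˡ (g []))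
pick (enumerates-allVecs {_≟_ = _≟_} {xs} en {suc n}) (a ∷ w) g = begin
  (Σ[ v ← allVecs xs (suc n) ] 𝟙 (v ≟ᵛ (a ∷ w)) * g v)
    ≡⟨ sumOver-allVecs-suc xs n _ ⟩
  (Σ[ x ← xs ] Σ[ v ← allVecs xs n ] 𝟙 ((x ∷ v) ≟ᵛ (a ∷ w)) * g (x ∷ v))
    ≡⟨ sumOver-cong xs (λ x → trans
         (sumOver-cong (allVecs xs n) λ v → trans
           (cong (_* g (x ∷ v)) (trans
             (𝟙-cong ((x ∷ v) ≟ᵛ (a ∷ w)) ((x ≟ a) ×-dec (v ≟ᵛ w)) Vec.∷-injective λ (x≡a , v≡w) → cong₂ _∷_ x≡a v≡w)
             (𝟙-× (x ≟ a) (v ≟ᵛ w))))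
           (ℚ.*-assoc (𝟙 (x ≟ a)) (𝟙 (v ≟ᵛ w)) (g (x ∷ v))))
         (sumOver-*ˡ (allVecs xs n) (𝟙 (x ≟ a)) (λ v → 𝟙 (v ≟ᵛ w) * g (x ∷ v)))) ⟩
  (Σ[ x ← xs ] 𝟙 (x ≟ a) * (Σ[ v ← allVecs xs n ] 𝟙 (v ≟ᵛ w) * g (x ∷ v)))
    ≡⟨ sumOver-cong xs (λ x → cong (𝟙 (x ≟ a) *_) (pick (enumerates-allVecs en) w (λ v → g (x ∷ v)))) ⟩
  (Σ[ x ← xs ] 𝟙 (x ≟ a) * g (x ∷ w))
    ≡⟨ pick en a (λ x → g (x ∷ w)) ⟩
  g (a ∷ w) ∎
  where
  _≟ᵛ_ : ∀ {n} → DecidableEquality (Vec _ n)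
  _≟ᵛ_ = Vec.≡-dec _≟_

enumerates-tabulate : ∀ {A : Set} (_≟_ : DecidableEquality A) {n} {f : Fin n → A} → Injective _≡_ _≡_ f →
  ∀ i (g : A → ℚ) → (Σ[ x ← List.tabulate f ] 𝟙 (x ≟ f i) * g x) ≡ g (f i)
enumerates-tabulate _≟_ {suc n} {f} inj zero g = begin
  𝟙 (f zero ≟ f zero) * g (f zero) + (Σ[ x ← List.tabulate (f ∘ suc) ] 𝟙 (x ≟ f zero) * g x)
    ≡⟨ cong₂ (λ u v → u * g (f zero) + v) (𝟙-true (f zero ≟ f zero) refl) (rest (f ∘ suc) λ i eq → Fin.0≢1+n (sym (inj eq))) ⟩
  1ℚ * g (f zero) + 0ℚ
    ≡⟨ trans (ℚ.+-identityʳ _) (ℚ.*-identityˡ _) ⟩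
  g (f zero) ∎
  where
  rest : ∀ {n} (h : Fin n → _) → (∀ i → h i ≢ f zero) → (Σ[ x ← List.tabulate h ] 𝟙 (x ≟ f zero) * g x) ≡ 0ℚ
  rest {zero}  h h≢ = refl
  rest {suc n} h h≢ = trans
    (cong₂ (λ u v → u * g (h zero) + v) (𝟙-false (h zero ≟ f zero) (h≢ zero)) (rest (h ∘ suc) (h≢ ∘ suc)))
    (trans (ℚ.+-identityʳ _) (ℚ.*-zeroˡ (g (h zero))))
enumerates-tabulate _≟_ {suc n} {f} inj (suc i) g = begin
  𝟙 (f zero ≟ f (suc i)) * g (f zero) + (Σ[ x ← List.tabulate (f ∘ suc) ] 𝟙 (x ≟ f (suc i)) * g x)
    ≡⟨ cong₂ (λ u v → u * g (f zero) + v) (𝟙-false (f zero ≟ f (suc i)) λ eq → Fin.0≢1+n (inj eq))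
         (enumerates-tabulate _≟_ (Fin.suc-injective ∘ inj) i g) ⟩
  0ℚ * g (f zero) + g (f (suc i))
    ≡⟨ trans (cong (_+ g (f (suc i))) (ℚ.*-zeroˡ (g (f zero)))) (ℚ.+-identityˡ _) ⟩
  g (f (suc i)) ∎

module _ {A B : Set} {_≟ᴬ_ : DecidableEquality A} {_≟ᴮ_ : DecidableEquality B} {xs : List A} {ys : List B}
         (enᴬ : Enumerates _≟ᴬ_ xs) (enᴮ : Enumerates _≟ᴮ_ ys) where

  -- Expand `g (f x)` as a delta sum over `ys` and exchange the summations; the coefficient of `g y`
  -- becomes the size of the fibre over `y`.
  sumOver-fibres : ∀ (f : A → B) (g : B → ℚ) →
    (Σ[ x ← xs ] g (f x)) ≡ (Σ[ y ← ys ] (Σ[ x ← xs ] 𝟙 (y ≟ᴮ f x)) * g y)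
  sumOver-fibres f g = begin
    (Σ[ x ← xs ] g (f x))
      ≡⟨ sumOver-cong xs (λ x → pick enᴮ (f x) g) ⟨
    (Σ[ x ← xs ] Σ[ y ← ys ] 𝟙 (y ≟ᴮ f x) * g y)
      ≡⟨ sumOver-swap xs ys (λ x y → 𝟙 (y ≟ᴮ f x) * g y) ⟩
    (Σ[ y ← ys ] Σ[ x ← xs ] 𝟙 (y ≟ᴮ f x) * g y)
      ≡⟨ sumOver-cong ys (λ y → sumOver-*ʳ xs (g y) (λ x → 𝟙 (y ≟ᴮ f x))) ⟩
    (Σ[ y ← ys ] (Σ[ x ← xs ] 𝟙 (y ≟ᴮ f x)) * g y) ∎

  -- By injectivity the fibre over `y` is a single point if `P y` holds, and it is empty otherwise.
  sumOver-image : ∀ {f : A → B} {P : B → Set} → Injective _≡_ _≡_ f → (P? : Decidable P) →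
    (∀ y → P y → ∃ λ x → f x ≡ y) → (∀ x → P (f x)) →
    ∀ (g : B → ℚ) → (Σ[ x ← xs ] g (f x)) ≡ (Σ[ y ← ys ] 𝟙 (P? y) * g y)
  sumOver-image {f} inj P? toX fromX g = trans (sumOver-fibres f g)
    (sumOver-cong ys λ y → cong (_* g y) (fibre y (P? y)))
    where
    fibre : ∀ y → (p? : Dec _) → (Σ[ x ← xs ] 𝟙 (y ≟ᴮ f x)) ≡ 𝟙 p?
    fibre y (yes py) with toX y py
    ... | a , fa≡y = trans
      (sumOver-cong xs λ x → 𝟙-cong (y ≟ᴮ f x) (x ≟ᴬ a)
        (λ y≡fx → sym (inj (trans fa≡y y≡fx))) (λ x≡a → trans (sym fa≡y) (cong f (sym x≡a))))
      (pick-1 enᴬ a)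
    fibre y (no ¬py) = trans
      (sumOver-cong xs λ x → 𝟙-false (y ≟ᴮ f x) (λ y≡fx → ¬py (subst _ (sym y≡fx) (fromX x))))
      (sumOver-0 xs)

sumOver-bijection : ∀ {A : Set} {_≟_ : DecidableEquality A} {xs : List A} → Enumerates _≟_ xs →
  (f f⁻¹ : A → A) → (∀ x → f⁻¹ (f x) ≡ x) → (∀ y → f (f⁻¹ y) ≡ y) →
  ∀ (g : A → ℚ) → (Σ[ x ← xs ] g (f x)) ≡ sumOver xs g
sumOver-bijection {xs = xs} en f f⁻¹ inverseˡ inverseʳ g = trans
  (sumOver-image en en (λ {x} {y} eq → trans (sym (inverseˡ x)) (trans (cong f⁻¹ eq) (inverseˡ y)))
    (λ _ → yes tt) (λ y _ → f⁻¹ y , inverseʳ y) (λ _ → tt) g)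
  (sumOver-cong xs (λ y → ℚ.*-identityˡ (g y)))

-- Row spaces and rank

module LinearAlgebra {q : ℕ} (F : FiniteField q) where

  private
    module F = FiniteField F
    module R where
      open CommutativeRing F.commutativeRing public
      open RingProperties (CommutativeRing.ring F.commutativeRing) public

  𝔽^_ : ℕ → Set
  𝔽^ n = Vec F.Carrier n

  0ᵛ : ∀ {n} → 𝔽^ n
  0ᵛ = replicate _ F.0#

  infixl 6 _+ᵛ_
  infixr 7 _*ᵛ_

  _+ᵛ_ : ∀ {n} → 𝔽^ n → 𝔽^ n → 𝔽^ n
  _+ᵛ_ = zipWith F._+_

  _*ᵛ_ : ∀ {n} → F.Carrier → 𝔽^ n → 𝔽^ n
  x *ᵛ v = map (x F.*_) v

  +ᵛ-comm : ∀ {n} (u v : 𝔽^ n) → u +ᵛ v ≡ v +ᵛ u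
  +ᵛ-comm = Vec.zipWith-comm R.+-comm

  +ᵛ-assoc : ∀ {n} (u v w : 𝔽^ n) → u +ᵛ v +ᵛ w ≡ u +ᵛ (v +ᵛ w)
  +ᵛ-assoc = Vec.zipWith-assoc R.+-assoc

  +ᵛ-identityˡ : ∀ {n} (v : 𝔽^ n) → 0ᵛ +ᵛ v ≡ v
  +ᵛ-identityˡ = Vec.zipWith-identityˡ R.+-identityˡ

  +ᵛ-identityʳ : ∀ {n} (v : 𝔽^ n) → v +ᵛ 0ᵛ ≡ v
  +ᵛ-identityʳ = Vec.zipWith-identityʳ R.+-identityʳ

  +ᵛ-interchange : ∀ {n} (u v w z : 𝔽^ n) → u +ᵛ v +ᵛ (w +ᵛ z) ≡ u +ᵛ w +ᵛ (v +ᵛ z)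
  +ᵛ-interchange u v w z = begin
    u +ᵛ v +ᵛ (w +ᵛ z)    ≡⟨ +ᵛ-assoc u v (w +ᵛ z) ⟩
    u +ᵛ (v +ᵛ (w +ᵛ z))  ≡⟨ cong (u +ᵛ_) (+ᵛ-assoc v w z) ⟨
    u +ᵛ (v +ᵛ w +ᵛ z)    ≡⟨ cong (λ x → u +ᵛ (x +ᵛ z)) (+ᵛ-comm v w) ⟩
    u +ᵛ (w +ᵛ v +ᵛ z)    ≡⟨ cong (u +ᵛ_) (+ᵛ-assoc w v z) ⟩
    u +ᵛ (w +ᵛ (v +ᵛ z))  ≡⟨ +ᵛ-assoc u w (v +ᵛ z) ⟨
    u +ᵛ w +ᵛ (v +ᵛ z)    ∎

  *ᵛ-distribˡ : ∀ {n} x (u v : 𝔽^ n) → x *ᵛ (u +ᵛ v) ≡ x *ᵛ u +ᵛ x *ᵛ v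
  *ᵛ-distribˡ x []      []      = refl
  *ᵛ-distribˡ x (a ∷ u) (b ∷ v) = cong₂ _∷_ (R.distribˡ x a b) (*ᵛ-distribˡ x u v)

  *ᵛ-distribʳ : ∀ {n} x y (v : 𝔽^ n) → (x F.+ y) *ᵛ v ≡ x *ᵛ v +ᵛ y *ᵛ v
  *ᵛ-distribʳ x y []      = refl
  *ᵛ-distribʳ x y (a ∷ v) = cong₂ _∷_ (R.distribʳ a x y) (*ᵛ-distribʳ x y v)

  *ᵛ-assoc : ∀ {n} x y (v : 𝔽^ n) → (x F.* y) *ᵛ v ≡ x *ᵛ y *ᵛ v
  *ᵛ-assoc x y []      = refl
  *ᵛ-assoc x y (a ∷ v) = cong₂ _∷_ (R.*-assoc x y a) (*ᵛ-assoc x y v)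

  *ᵛ-identity : ∀ {n} (v : 𝔽^ n) → F.1# *ᵛ v ≡ v
  *ᵛ-identity []      = refl
  *ᵛ-identity (a ∷ v) = cong₂ _∷_ (R.*-identityˡ a) (*ᵛ-identity v)

  *ᵛ-zeroˡ : ∀ {n} (v : 𝔽^ n) → F.0# *ᵛ v ≡ 0ᵛ
  *ᵛ-zeroˡ []      = refl
  *ᵛ-zeroˡ (a ∷ v) = cong₂ _∷_ (R.zeroˡ a) (*ᵛ-zeroˡ v)

  *ᵛ-zeroʳ : ∀ {n} x → x *ᵛ 0ᵛ {n} ≡ 0ᵛ
  *ᵛ-zeroʳ {n} x = trans (Vec.map-replicate (x F.*_) F.0# n) (cong (replicate n) (R.zeroʳ x))

  +ᵛ-inverseʳ : ∀ {n} x (v : 𝔽^ n) → x *ᵛ v +ᵛ (F.- x) *ᵛ v ≡ 0ᵛ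
  +ᵛ-inverseʳ x v = trans (sym (*ᵛ-distribʳ x (F.- x) v))
    (trans (cong (_*ᵛ v) (R.-‿inverseʳ x)) (*ᵛ-zeroˡ v))

  +ᵛ-cancel : ∀ {n} x (u v : 𝔽^ n) → u +ᵛ x *ᵛ v +ᵛ (F.- x) *ᵛ v ≡ u
  +ᵛ-cancel x u v = trans (+ᵛ-assoc u (x *ᵛ v) ((F.- x) *ᵛ v))
    (trans (cong (u +ᵛ_) (+ᵛ-inverseʳ x v)) (+ᵛ-identityʳ u))

  +ᵛ-cancel⁻ : ∀ {n} x (u v : 𝔽^ n) → u +ᵛ (F.- x) *ᵛ v +ᵛ x *ᵛ v ≡ u
  +ᵛ-cancel⁻ x u v = trans (cong (λ y → u +ᵛ (F.- x) *ᵛ v +ᵛ y *ᵛ v) (sym (R.-‿involutive x)))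
    (+ᵛ-cancel (F.- x) u v)

  comb : ∀ {k m} → 𝔽^ k → Matrix F k m → 𝔽^ m
  comb []      []      = 0ᵛ
  comb (x ∷ c) (v ∷ M) = x *ᵛ v +ᵛ comb c M

  rowCombination≡comb : ∀ {k m} (c : 𝔽^ k) (M : Matrix F k m) → rowCombination F c M ≡ comb c M
  rowCombination≡comb c M = trans (Vec.tabulate-cong (pointwise c M)) (Vec.tabulate∘lookup (comb c M))
    where
    module ΣF = CommutativeMonoidSum F.+-commutativeMonoid
    pointwise : ∀ {k m} (c : 𝔽^ k) (M : Matrix F k m) j →
      ΣF.sum (λ i → lookup c i F.* lookup (lookup M i) j) ≡ lookup (comb c M) j
    pointwise []      []      j = sym (Vec.lookup-replicate j F.0#)
    pointwise (x ∷ c) (v ∷ M) j = trans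
      (cong₂ F._+_ (sym (Vec.lookup-map j (x F.*_) v)) (pointwise c M j))
      (sym (Vec.lookup-zipWith F._+_ j (x *ᵛ v) (comb c M)))

  infix 4 _∈ᵣ_ _∈ᵣ?_

  record _∈ᵣ_ {k m} (v : 𝔽^ m) (M : Matrix F k m) : Set where
    constructor combination
    field
      coefficients : 𝔽^ k
      comb≡        : comb coefficients M ≡ v

  ∈ᵣ⇔InRowSpace : ∀ {k m} {v : 𝔽^ m} {M : Matrix F k m} → v ∈ᵣ M ⇔ InRowSpace F M v
  ∈ᵣ⇔InRowSpace {M = M} = mk⇔ (λ (combination c eq) → c , trans (rowCombination≡comb c M) eq)
                              (λ (c , eq) → combination c (trans (sym (rowCombination≡comb c M)) eq))

  _∈ᵣ?_ : ∀ {k m} (v : 𝔽^ m) (M : Matrix F k m) → Dec (v ∈ᵣ M)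
  v ∈ᵣ? M = map′ (Equivalence.from ∈ᵣ⇔InRowSpace) (Equivalence.to ∈ᵣ⇔InRowSpace) (inRowSpace? F M v)

  comb-+ᵛ : ∀ {k m} (c d : 𝔽^ k) (M : Matrix F k m) → comb (c +ᵛ d) M ≡ comb c M +ᵛ comb d M
  comb-+ᵛ []      []      []      = sym (+ᵛ-identityˡ 0ᵛ)
  comb-+ᵛ (x ∷ c) (y ∷ d) (v ∷ M) = trans (cong₂ _+ᵛ_ (*ᵛ-distribʳ x y v) (comb-+ᵛ c d M))
    (+ᵛ-interchange (x *ᵛ v) (y *ᵛ v) (comb c M) (comb d M))

  comb-*ᵛ : ∀ {k m} x (c : 𝔽^ k) (M : Matrix F k m) → comb (x *ᵛ c) M ≡ x *ᵛ comb c M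
  comb-*ᵛ x []      []      = sym (*ᵛ-zeroʳ x)
  comb-*ᵛ x (y ∷ c) (v ∷ M) = trans (cong₂ _+ᵛ_ (*ᵛ-assoc x y v) (comb-*ᵛ x c M))
    (sym (*ᵛ-distribˡ x (y *ᵛ v) (comb c M)))

  comb-0ᵛ : ∀ {k m} (M : Matrix F k m) → comb 0ᵛ M ≡ 0ᵛ
  comb-0ᵛ []      = refl
  comb-0ᵛ (v ∷ M) = trans (cong₂ _+ᵛ_ (*ᵛ-zeroˡ v) (comb-0ᵛ M)) (+ᵛ-identityˡ 0ᵛ)

  module _ {k m : ℕ} {M : Matrix F k m} where

    0ᵛ∈ᵣ : 0ᵛ ∈ᵣ M
    0ᵛ∈ᵣ = combination 0ᵛ (comb-0ᵛ M)

    +ᵛ∈ᵣ : ∀ {u v} → u ∈ᵣ M → v ∈ᵣ M → u +ᵛ v ∈ᵣ M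
    +ᵛ∈ᵣ (combination c c≡) (combination d d≡) = combination (c +ᵛ d) (trans (comb-+ᵛ c d M) (cong₂ _+ᵛ_ c≡ d≡))

    *ᵛ∈ᵣ : ∀ x {v} → v ∈ᵣ M → x *ᵛ v ∈ᵣ M
    *ᵛ∈ᵣ x (combination c c≡) = combination (x *ᵛ c) (trans (comb-*ᵛ x c M) (cong (x *ᵛ_) c≡))

    ∷∈ᵣ : ∀ x u {w} → w ∈ᵣ M → x *ᵛ u +ᵛ w ∈ᵣ u ∷ M
    ∷∈ᵣ x u (combination c c≡) = combination (x ∷ c) (cong (x *ᵛ u +ᵛ_) c≡)

    ∷∈ᵣ⁻ : ∀ {u v} → v ∈ᵣ u ∷ M → ∃[ x ] ∃[ w ] w ∈ᵣ M × x *ᵛ u +ᵛ w ≡ v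
    ∷∈ᵣ⁻ (combination (x ∷ c) eq) = x , comb c M , combination c refl , eq

    there∈ᵣ : ∀ u {v} → v ∈ᵣ M → v ∈ᵣ u ∷ M
    there∈ᵣ u {v} v∈ = subst (_∈ᵣ u ∷ M) (trans (cong (_+ᵛ v) (*ᵛ-zeroˡ u)) (+ᵛ-identityˡ v)) (∷∈ᵣ F.0# u v∈)

    here∈ᵣ : ∀ u → u ∈ᵣ u ∷ M
    here∈ᵣ u = subst (_∈ᵣ u ∷ M) (trans (+ᵛ-identityʳ (F.1# *ᵛ u)) (*ᵛ-identity u)) (∷∈ᵣ F.1# u 0ᵛ∈ᵣ)

    +ᵛ∈ᵣ⁻ : ∀ x {u v} → v ∈ᵣ M → u +ᵛ x *ᵛ v ∈ᵣ M → u ∈ᵣ M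
    +ᵛ∈ᵣ⁻ x {u} {v} v∈ u+xv∈ = subst (_∈ᵣ M) (+ᵛ-cancel x u v) (+ᵛ∈ᵣ u+xv∈ (*ᵛ∈ᵣ (F.- x) v∈))

  infix 4 _≈ᵣ_

  _≈ᵣ_ : ∀ {j k m} → Matrix F j m → Matrix F k m → Set
  M ≈ᵣ N = ∀ v → v ∈ᵣ M ⇔ v ∈ᵣ N

  ∷-≈ᵣ : ∀ {j k m} u {M : Matrix F j m} {N : Matrix F k m} → M ≈ᵣ N → u ∷ M ≈ᵣ u ∷ N
  ∷-≈ᵣ u M≈N v = mk⇔ (λ v∈ → let x , w , w∈ , eq = ∷∈ᵣ⁻ v∈ in subst (_∈ᵣ _) eq (∷∈ᵣ x u (Equivalence.to (M≈N w) w∈)))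
                     (λ v∈ → let x , w , w∈ , eq = ∷∈ᵣ⁻ v∈ in subst (_∈ᵣ _) eq (∷∈ᵣ x u (Equivalence.from (M≈N w) w∈)))

  ≈ᵣ-trans : ∀ {i j k m} {M : Matrix F i m} {N : Matrix F j m} {P : Matrix F k m} → M ≈ᵣ N → N ≈ᵣ P → M ≈ᵣ P
  ≈ᵣ-trans M≈N N≈P v = N≈P v Composition.⇔-∘ M≈N v

  ∷-redundant : ∀ {k m u} {M : Matrix F k m} → u ∈ᵣ M → M ≈ᵣ u ∷ M
  ∷-redundant {u = u} u∈ v = mk⇔ (there∈ᵣ u) λ v∈ →
    let x , w , w∈ , eq = ∷∈ᵣ⁻ v∈ in subst (_∈ᵣ _) eq (+ᵛ∈ᵣ (*ᵛ∈ᵣ x u∈) w∈)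

  ∷-swap : ∀ {k m} u v {M : Matrix F k m} → u ∷ v ∷ M ≈ᵣ v ∷ u ∷ M
  ∷-swap {m = m} u v w = mk⇔ (half u v) (half v u)
    where
    half : ∀ (u v : 𝔽^ m) {k} {M : Matrix F k m} {w} → w ∈ᵣ u ∷ v ∷ M → w ∈ᵣ v ∷ u ∷ M
    half u v {M = M} w∈ with ∷∈ᵣ⁻ w∈
    ... | x , w₁ , w₁∈ , refl with ∷∈ᵣ⁻ w₁∈
    ... | y , w₂ , w₂∈ , refl = subst (_∈ᵣ v ∷ u ∷ M) eq (∷∈ᵣ y v (∷∈ᵣ x u w₂∈))
      where
      eq : y *ᵛ v +ᵛ (x *ᵛ u +ᵛ w₂) ≡ x *ᵛ u +ᵛ (y *ᵛ v +ᵛ w₂)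
      eq = trans (sym (+ᵛ-assoc (y *ᵛ v) (x *ᵛ u) w₂))
        (trans (cong (_+ᵛ w₂) (+ᵛ-comm (y *ᵛ v) (x *ᵛ u))) (+ᵛ-assoc (x *ᵛ u) (y *ᵛ v) w₂))

  ∷ʳ-≈ᵣ : ∀ {k m} (M : Matrix F k m) v → M ∷ʳ v ≈ᵣ v ∷ M
  ∷ʳ-≈ᵣ []      v w = mk⇔ id id
  ∷ʳ-≈ᵣ (u ∷ M) v   = ≈ᵣ-trans (∷-≈ᵣ u (∷ʳ-≈ᵣ M v)) (∷-swap u v)

  rank-∷ : ∀ {P : Set} → Dec P → ℕ → ℕ
  rank-∷ (yes _) n = n
  rank-∷ (no  _) n = suc n

  -- Greedy selection from the bottom: a row counts exactly when it lies outside the span of the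
  -- rows below it. This recursion is what counting row by row uses; `hasRank⇔rank` identifies it
  -- with the definition through bases.
  rank : ∀ {k m} → Matrix F k m → ℕ
  rank []      = 0
  rank (v ∷ M) = rank-∷ (v ∈ᵣ? M) (rank M)

  Independent : ∀ {k m} → Matrix F k m → Set
  Independent B = ∀ c → comb c B ≡ 0ᵛ → c ≡ 0ᵛ

  -- In a vanishing combination the coefficient `x` of `u` must be 0: otherwise `x *ᵛ u` lies in the
  -- row space of `B`, and multiplying by the inverse `y` of `x` puts `u` there too.
  independent-∷ : ∀ {k m u} (B : Matrix F k m) → ¬ u ∈ᵣ B → Independent B → Independent (u ∷ B)
  independent-∷ {u = u} B u∉ indep (x ∷ c) eq with x F.≟ F.0#
  ... | yes refl = cong (F.0# ∷_) (indep c (begin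
    comb c B                    ≡⟨ +ᵛ-identityˡ (comb c B) ⟨
    0ᵛ +ᵛ comb c B              ≡⟨ cong (_+ᵛ comb c B) (*ᵛ-zeroˡ u) ⟨
    comb (F.0# ∷ c) (u ∷ B)     ≡⟨ eq ⟩
    0ᵛ                          ∎))
  ... | no x≢0 with y , xy≡1 ← F.inverse x x≢0 = contradiction
    (subst (_∈ᵣ B) yxu≡u (*ᵛ∈ᵣ y (+ᵛ∈ᵣ⁻ F.1# (combination c refl) (subst (_∈ᵣ B) (sym sum≡0) 0ᵛ∈ᵣ)))) u∉
    where
    sum≡0 : x *ᵛ u +ᵛ F.1# *ᵛ comb c B ≡ 0ᵛ
    sum≡0 = trans (cong (x *ᵛ u +ᵛ_) (*ᵛ-identity (comb c B))) eq
    yxu≡u : y *ᵛ x *ᵛ u ≡ u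
    yxu≡u = trans (sym (*ᵛ-assoc y x u)) (trans (cong (_*ᵛ u) (trans (R.*-comm y x) xy≡1)) (*ᵛ-identity u))

  IsBasis : ∀ {j k m} → Matrix F j m → Matrix F k m → Set
  IsBasis B M = Independent B × B ≈ᵣ M

  hasRank⇔basis : ∀ {k m t} {M : Matrix F k m} → HasRank F M t ⇔ ∃ λ (B : Matrix F t m) → IsBasis B M
  hasRank⇔basis = mk⇔
    (λ (B , indep , B≈M) → B , (λ c eq → indep c (trans (rowCombination≡comb c B) eq)) , λ v → mk⇔
      (λ v∈ → Equivalence.from ∈ᵣ⇔InRowSpace (Equivalence.to (B≈M v) (Equivalence.to ∈ᵣ⇔InRowSpace v∈)))
      (λ v∈ → Equivalence.from ∈ᵣ⇔InRowSpace (Equivalence.from (B≈M v) (Equivalence.to ∈ᵣ⇔InRowSpace v∈))))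
    (λ (B , indep , B≈M) → B , (λ c eq → indep c (trans (sym (rowCombination≡comb c B)) eq)) , λ v → mk⇔
      (λ v∈ → Equivalence.to ∈ᵣ⇔InRowSpace (Equivalence.to (B≈M v) (Equivalence.from ∈ᵣ⇔InRowSpace v∈)))
      (λ v∈ → Equivalence.to ∈ᵣ⇔InRowSpace (Equivalence.from (B≈M v) (Equivalence.from ∈ᵣ⇔InRowSpace v∈))))

  -- The rows counted by `rank` form the basis.
  rank-basis : ∀ {k m} (M : Matrix F k m) → ∃ λ (B : Matrix F (rank M) m) → IsBasis B M
  rank-basis []      = [] , (λ { [] _ → refl }) , λ v → mk⇔ id id
  rank-basis (u ∷ M) with u ∈ᵣ? M | rank-basis M
  ... | yes u∈ | B , indep , B≈M = B , indep , ≈ᵣ-trans B≈M (∷-redundant u∈)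
  ... | no  u∉ | B , indep , B≈M =
    u ∷ B , independent-∷ B (λ u∈B → u∉ (Equivalence.to (B≈M u) u∈B)) indep , ∷-≈ᵣ u B≈M

  -- Sizes of row spaces and invariance of the rank

  enumerates-elements : Enumerates F._≟_ F.elements
  enumerates-elements .Enumerates.pick a g = begin
    sumOver F.elements (λ x → 𝟙 (x F.≟ a) * g x)
      ≡⟨ cong (λ xs → sumOver xs (λ x → 𝟙 (x F.≟ a) * g x)) (List.map-tabulate id to) ⟩
    sumOver (List.tabulate to) (λ x → 𝟙 (x F.≟ a) * g x)
      ≡⟨ cong (λ b → sumOver (List.tabulate to) (λ x → 𝟙 (x F.≟ b) * g x)) (strictlyInverseˡ a) ⟨
    sumOver (List.tabulate to) (λ x → 𝟙 (x F.≟ to (from a)) * g x)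
      ≡⟨ enumerates-tabulate F._≟_ (Injection.injective (↔⇒↣ F.enumeration)) (from a) g ⟩
    g (to (from a))
      ≡⟨ cong g (strictlyInverseˡ a) ⟩
    g a ∎
    where open Inverse F.enumeration

  vectors : ∀ n → List (𝔽^ n)
  vectors n = allVecs F.elements n

  enumerates-vectors : ∀ {n} → Enumerates (Vec.≡-dec F._≟_) (vectors n)
  enumerates-vectors = enumerates-allVecs enumerates-elements

  sum-elements-const : ∀ c → (Σ[ x ← F.elements ] c) ≡ fromℕ q * c
  sum-elements-const c = begin
    sumOver F.elements (λ _ → c)                   ≡⟨ sumOver-const F.elements ⟩
    fromℕ (List.length F.elements) * c
      ≡⟨ cong (λ n → fromℕ n * c) (trans (List.length-map (Inverse.to F.enumeration) (List.allFin q)) (List.length-tabulate {n = q} id)) ⟩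
    fromℕ q * c ∎
    where
    sumOver-const : ∀ (xs : List F.Carrier) → sumOver xs (λ _ → c) ≡ fromℕ (List.length xs) * c
    sumOver-const []       = sym (ℚ.*-zeroˡ c)
    sumOver-const (x ∷ xs) = begin
      c + sumOver xs (λ _ → c)               ≡⟨ cong₂ _+_ (sym (ℚ.*-identityˡ c)) (sumOver-const xs) ⟩
      1ℚ * c + fromℕ (List.length xs) * c    ≡⟨ ℚ.*-distribʳ-+ c 1ℚ (fromℕ (List.length xs)) ⟨
      (1ℚ + fromℕ (List.length xs)) * c      ≡⟨ cong (_* c) (fromℕ-+ 1 (List.length xs)) ⟨
      fromℕ (suc (List.length xs)) * c       ∎

  sum-vectors-1 : ∀ n → (Σ[ v ← vectors n ] 1ℚ) ≡ fromℕ (q ^ n)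
  sum-vectors-1 zero    = refl
  sum-vectors-1 (suc n) = begin
    (Σ[ v ← vectors (suc n) ] 1ℚ)                ≡⟨ sumOver-allVecs-suc F.elements n _ ⟩
    (Σ[ x ← F.elements ] Σ[ v ← vectors n ] 1ℚ)  ≡⟨ sum-elements-const (Σ[ v ← vectors n ] 1ℚ) ⟩
    fromℕ q * (Σ[ v ← vectors n ] 1ℚ)            ≡⟨ cong (fromℕ q *_) (sum-vectors-1 n) ⟩
    fromℕ q * fromℕ (q ^ n)                      ≡⟨ fromℕ-* q (q ^ n) ⟨
    fromℕ (q ^ suc n) ∎

  comb-injective : ∀ {k m} (B : Matrix F k m) → Independent B → ∀ {c d} → comb c B ≡ comb d B → c ≡ d
  comb-injective B indep {c} {d} eq = begin
    c                                 ≡⟨ +ᵛ-cancel⁻ F.1# c d ⟨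
    c +ᵛ (F.- F.1#) *ᵛ d +ᵛ F.1# *ᵛ d  ≡⟨ cong (_+ᵛ F.1# *ᵛ d) difference≡0 ⟩
    0ᵛ +ᵛ F.1# *ᵛ d                   ≡⟨ +ᵛ-identityˡ (F.1# *ᵛ d) ⟩
    F.1# *ᵛ d                         ≡⟨ *ᵛ-identity d ⟩
    d                                 ∎
    where
    difference≡0 : c +ᵛ (F.- F.1#) *ᵛ d ≡ 0ᵛ
    difference≡0 = indep _ (begin
      comb (c +ᵛ (F.- F.1#) *ᵛ d) B                ≡⟨ comb-+ᵛ c ((F.- F.1#) *ᵛ d) B ⟩
      comb c B +ᵛ comb ((F.- F.1#) *ᵛ d) B         ≡⟨ cong₂ _+ᵛ_ (trans eq (sym (*ᵛ-identity (comb d B)))) (comb-*ᵛ (F.- F.1#) d B) ⟩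
      F.1# *ᵛ comb d B +ᵛ (F.- F.1#) *ᵛ comb d B   ≡⟨ +ᵛ-inverseʳ F.1# (comb d B) ⟩
      0ᵛ                                           ∎)

  -- Taking combinations of the `j` basis rows maps the `q^j` coefficient vectors bijectively onto
  -- the row space.
  rowSpace-size : ∀ {j k m} {B : Matrix F j m} {M : Matrix F k m} → IsBasis B M →
    (Σ[ v ← vectors m ] 𝟙 (v ∈ᵣ? M)) ≡ fromℕ (q ^ j)
  rowSpace-size {j} {m = m} {B} {M} (indep , B≈M) = begin
    (Σ[ v ← vectors m ] 𝟙 (v ∈ᵣ? M))
      ≡⟨ sumOver-cong (vectors m) (λ v → ℚ.*-identityʳ (𝟙 (v ∈ᵣ? M))) ⟨
    (Σ[ v ← vectors m ] 𝟙 (v ∈ᵣ? M) * 1ℚ)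
      ≡⟨ sumOver-image (enumerates-vectors {j}) enumerates-vectors {f = λ c → comb c B} (comb-injective B indep) (_∈ᵣ? M)
           (λ v v∈ → let combination c eq = Equivalence.from (B≈M v) v∈ in c , eq)
           (λ c → Equivalence.to (B≈M (comb c B)) (combination c refl)) (λ _ → 1ℚ) ⟨
    (Σ[ c ← vectors j ] 1ℚ)
      ≡⟨ sum-vectors-1 j ⟩
    fromℕ (q ^ j) ∎

  rowSpace-size-rank : ∀ {k m} (M : Matrix F k m) → (Σ[ v ← vectors m ] 𝟙 (v ∈ᵣ? M)) ≡ fromℕ (q ^ rank M)
  rowSpace-size-rank M = rowSpace-size (proj₂ (rank-basis M))

  module _ .{{q-nonTrivial : NonTrivial q}} where

    -- Both lengths give the size of the same row space, `q^i = q^j`, and powers of `q > 1` are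
    -- strictly increasing.
    basis-length : ∀ {i j k m} {B : Matrix F i m} {B′ : Matrix F j m} {M : Matrix F k m} →
      IsBasis B M → IsBasis B′ M → i ≡ j
    basis-length {i} {j} basis basis′
      with ℕ.<-cmp i j | fromℕ-injective (trans (sym (rowSpace-size basis)) (rowSpace-size basis′))
    ... | tri≈ _ i≡j _ | _  = i≡j
    ... | tri< i<j _ _ | eq = contradiction eq (ℕ.<⇒≢ (ℕ.^-monoʳ-< q (nonTrivial⇒n>1 q) i<j))
    ... | tri> _ _ j<i | eq = contradiction (sym eq) (ℕ.<⇒≢ (ℕ.^-monoʳ-< q (nonTrivial⇒n>1 q) j<i))

    hasRank⇔rank : ∀ {k m} (M : Matrix F k m) t → HasRank F M t ⇔ rank M ≡ t
    hasRank⇔rank M t = mk⇔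
      (λ h → basis-length (proj₂ (rank-basis M)) (proj₂ (Equivalence.to hasRank⇔basis h)))
      (λ { refl → Equivalence.from hasRank⇔basis (rank-basis M) })

    rank-cong : ∀ {j k m} {M : Matrix F j m} {N : Matrix F k m} → M ≈ᵣ N → rank M ≡ rank N
    rank-cong {M = M} {N} M≈N =
      let B , indep , B≈M = rank-basis M
      in basis-length (indep , ≈ᵣ-trans B≈M M≈N) (proj₂ (rank-basis N))

-- Adding a row

module Counting {q : ℕ} .{{q-nonTrivial : NonTrivial q}} (F : FiniteField q) where

  open QAlgebra q
  open LinearAlgebra F

  private
    module F = FiniteField F
    module R where
      open CommutativeRing F.commutativeRing public
      open RingProperties (CommutativeRing.ring F.commutativeRing) public

  -- The partial trace without its side conditions: entries outside the matrix count as 0.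
  τ : ∀ {ℓ m} → ℕ → Matrix F ℓ m → F.Carrier
  τ zero    M             = F.0#
  τ (suc r) []            = F.0#
  τ (suc r) ([] ∷ M)      = F.0#
  τ (suc r) ((x ∷ v) ∷ M) = x F.+ τ r (map tail M)

  τ-∷ : ∀ {ℓ m} r (v : 𝔽^ suc m) (M : Matrix F ℓ (suc m)) → τ (suc r) (v ∷ M) ≡ head v F.+ τ r (map tail M)
  τ-∷ r (x ∷ v) M = refl

  lookup-tail : ∀ {A : Set} {n} (v : Vec A (suc n)) i → lookup v (suc i) ≡ lookup (tail v) i
  lookup-tail (x ∷ v) i = refl

  partialTrace≡τ : ∀ {ℓ m} r .(r≤ℓ : r ≤ ℓ) .(ℓ≤m : ℓ ≤ m) (M : Matrix F ℓ m) → partialTrace F r r≤ℓ ℓ≤m M ≡ τ r M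
  partialTrace≡τ zero    r≤ℓ ℓ≤m M             = refl
  partialTrace≡τ (suc r) ()  ℓ≤m []
  partialTrace≡τ (suc r) r≤ℓ ()  ([] ∷ M)
  partialTrace≡τ {suc ℓ} {suc m} (suc r) r≤ℓ ℓ≤m ((x ∷ v) ∷ M) = cong (x F.+_) (trans
    (ΣF.sum-cong-≗ λ i → trans (lookup-tail (lookup M (row i)) (column i)) (cong (λ u → lookup u (column i)) (sym (Vec.lookup-map (row i) tail M))))
    (partialTrace≡τ r (ℕ.s≤s⁻¹ r≤ℓ) (ℕ.s≤s⁻¹ ℓ≤m) (map tail M)))
    where
    module ΣF = CommutativeMonoidSum F.+-commutativeMonoid
    row : Fin r → Fin ℓ
    row i = inject≤ i (ℕ.s≤s⁻¹ r≤ℓ)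
    column : Fin r → Fin m
    column i = inject≤ i (ℕ.≤-trans (ℕ.s≤s⁻¹ r≤ℓ) (ℕ.s≤s⁻¹ ℓ≤m))

  -- The appended row comes after `ℓ ≥ r` others, so it holds none of the first `r` diagonal
  -- entries.
  τ-∷ʳ : ∀ {ℓ m} r → r ≤ ℓ → (M : Matrix F ℓ m) (v : 𝔽^ m) → τ r (M ∷ʳ v) ≡ τ r M
  τ-∷ʳ zero    _         M             v = refl
  τ-∷ʳ (suc r) (s≤s r≤ℓ) ([] ∷ M)      v = refl
  τ-∷ʳ (suc r) (s≤s r≤ℓ) ((x ∷ u) ∷ M) v = cong (x F.+_)
    (trans (cong (τ r) (Vec.map-∷ʳ tail v M)) (τ-∷ʳ r r≤ℓ (map tail M) (tail v)))

  -- One sum for both purposes: the constant weight 1 counts matrices of rank `t`, and the balanced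
  -- weight of the last part gives the sum that measures how the traces are distributed. Rows below
  -- the trace obey the same recurrence for every weight.
  weightedCount : (F.Carrier → ℚ) → (r ℓ m t : ℕ) → ℚ
  weightedCount χ r ℓ m t = Σ[ M ← allMatrices F ℓ m ] 𝟙 (rank M ℕ.≟ t) * χ (τ r M)

  𝟙-rank-∷ : ∀ {P : Set} (p? : Dec P) n t →
    𝟙 (rank-∷ p? n ℕ.≟ t) ≡ 𝟙 (n ℕ.≟ t) * 𝟙 p? + 𝟙 (suc n ℕ.≟ t) * (1ℚ - 𝟙 p?)
  𝟙-rank-∷ (yes _) n t = solve 2 (λ x y → x := x :* con 1ℚ :+ y :* (con 1ℚ :- con 1ℚ)) refl (𝟙 (n ℕ.≟ t)) (𝟙 (suc n ℕ.≟ t))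
  𝟙-rank-∷ (no _)  n t = solve 2 (λ x y → y := x :* con 0ℚ :+ y :* (con 1ℚ :- con 0ℚ)) refl (𝟙 (n ℕ.≟ t)) (𝟙 (suc n ℕ.≟ t))

  𝟙-suc : ∀ n t → 𝟙 (suc n ℕ.≟ suc t) ≡ 𝟙 (n ℕ.≟ t)
  𝟙-suc n t = 𝟙-cong (suc n ℕ.≟ suc t) (n ℕ.≟ t) ℕ.suc-injective (cong suc)

  -- Under the indicator the rank of the matrix may be replaced by the fixed `t`; the coefficient
  -- can then be pulled out of the sum over matrices.
  𝟙-*-Q : ∀ n t → 𝟙 (n ℕ.≟ t) * Q n ≡ 𝟙 (n ℕ.≟ t) * Q t
  𝟙-*-Q n t with n ℕ.≟ t
  ... | yes refl = refl
  ... | no _     = trans (ℚ.*-zeroˡ (Q n)) (sym (ℚ.*-zeroˡ (Q t)))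

  -- A row inside the row space keeps the rank, any other raises it by one, and the outside sum is
  -- the total minus the inside sum. The weight `f` may vary with the row, as it does for a row that
  -- meets the trace.
  sum-rank-∷ : ∀ {ℓ m} (M : Matrix F ℓ m) t (f : 𝔽^ m → ℚ) →
    let inside = Σ[ v ← vectors m ] 𝟙 (v ∈ᵣ? M) * f v in
    (Σ[ v ← vectors m ] 𝟙 (rank (v ∷ M) ℕ.≟ t) * f v)
      ≡ 𝟙 (rank M ℕ.≟ t) * inside + 𝟙 (suc (rank M) ℕ.≟ t) * (sumOver (vectors m) f - inside)
  sum-rank-∷ {m = m} M t f = begin
    (Σ[ v ← vectors m ] 𝟙 (rank (v ∷ M) ℕ.≟ t) * f v)
      ≡⟨ sumOver-cong (vectors m) (λ v → trans (cong (_* f v) (𝟙-rank-∷ (v ∈ᵣ? M) (rank M) t))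
           (solve 4 (λ x y p f → (x :* p :+ y :* (con 1ℚ :- p)) :* f := (x :- y) :* (p :* f) :+ y :* f) refl δ δ′ (𝟙 (v ∈ᵣ? M)) (f v))) ⟩
    (Σ[ v ← vectors m ] ((δ - δ′) * (𝟙 (v ∈ᵣ? M) * f v) + δ′ * f v))
      ≡⟨ sumOver-linear (vectors m) (δ - δ′) δ′ (λ v → 𝟙 (v ∈ᵣ? M) * f v) f ⟩
    (δ - δ′) * inside + δ′ * sumOver (vectors m) f
      ≡⟨ solve 4 (λ x y i s → (x :- y) :* i :+ y :* s := x :* i :+ y :* (s :- i)) refl δ δ′ inside (sumOver (vectors m) f) ⟩
    δ * inside + δ′ * (sumOver (vectors m) f - inside) ∎
    where
    inside = Σ[ v ← vectors m ] 𝟙 (v ∈ᵣ? M) * f v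
    δ  = 𝟙 (rank M ℕ.≟ t)
    δ′ = 𝟙 (suc (rank M) ℕ.≟ t)

  rank-∷ʳ : ∀ {ℓ m} (M : Matrix F ℓ m) v → rank (M ∷ʳ v) ≡ rank (v ∷ M)
  rank-∷ʳ M v = rank-cong (∷ʳ-≈ᵣ M v)

  -- Rows below the trace

  module _ (χ : F.Carrier → ℚ) where

    -- At the bottom the new row does not alter the trace, so the weight is constant in it and only
    -- the numbers of rows enter: `q^rank` inside the row space of `M` and `q^m - q^rank` outside.
    weightedCount-∷ʳ : ∀ {r ℓ m} t → r ≤ ℓ → weightedCount χ r (suc ℓ) m t ≡
      (Σ[ M ← allMatrices F ℓ m ] (𝟙 (rank M ℕ.≟ t) * Q (rank M) + 𝟙 (suc (rank M) ℕ.≟ t) * (Q m - Q (rank M))) * χ (τ r M))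
    weightedCount-∷ʳ {r} {ℓ} {m} t r≤ℓ = trans
      (sumOver-allVecs-∷ʳ (vectors m) ℓ (λ M → 𝟙 (rank M ℕ.≟ t) * χ (τ r M)))
      (sumOver-cong (allMatrices F ℓ m) λ M → begin
        (Σ[ v ← vectors m ] 𝟙 (rank (M ∷ʳ v) ℕ.≟ t) * χ (τ r (M ∷ʳ v)))
          ≡⟨ sumOver-cong (vectors m) (λ v → cong₂ (λ n x → 𝟙 (n ℕ.≟ t) * χ x) (rank-∷ʳ M v) (τ-∷ʳ r r≤ℓ M v)) ⟩
        (Σ[ v ← vectors m ] 𝟙 (rank (v ∷ M) ℕ.≟ t) * χ (τ r M))
          ≡⟨ sum-rank-∷ M t (λ _ → χ (τ r M)) ⟩
        𝟙 (rank M ℕ.≟ t) * (Σ[ v ← vectors m ] 𝟙 (v ∈ᵣ? M) * χ (τ r M))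
          + 𝟙 (suc (rank M) ℕ.≟ t) * ((Σ[ v ← vectors m ] χ (τ r M)) - (Σ[ v ← vectors m ] 𝟙 (v ∈ᵣ? M) * χ (τ r M)))
          ≡⟨ cong₂ (λ i s → 𝟙 (rank M ℕ.≟ t) * i + 𝟙 (suc (rank M) ℕ.≟ t) * (s - i))
               (trans (sumOver-*ʳ (vectors m) (χ (τ r M)) (λ v → 𝟙 (v ∈ᵣ? M))) (cong (_* χ (τ r M)) (rowSpace-size-rank M)))
               (trans (sumOver-cong (vectors m) (λ _ → sym (ℚ.*-identityˡ (χ (τ r M)))))
                 (trans (sumOver-*ʳ (vectors m) (χ (τ r M)) (λ _ → 1ℚ)) (cong (_* χ (τ r M)) (sum-vectors-1 m)))) ⟩
        𝟙 (rank M ℕ.≟ t) * (Q (rank M) * χ (τ r M)) + 𝟙 (suc (rank M) ℕ.≟ t) * (Q m * χ (τ r M) - Q (rank M) * χ (τ r M))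
          ≡⟨ solve 5 (λ x y a b c → x :* (a :* c) :+ y :* (b :* c :- a :* c) := (x :* a :+ y :* (b :- a)) :* c) refl
               (𝟙 (rank M ℕ.≟ t)) (𝟙 (suc (rank M) ℕ.≟ t)) (Q (rank M)) (Q m) (χ (τ r M)) ⟩
        (𝟙 (rank M ℕ.≟ t) * Q (rank M) + 𝟙 (suc (rank M) ℕ.≟ t) * (Q m - Q (rank M))) * χ (τ r M) ∎)

    untracedRow-0 : ∀ {r ℓ m} → r ≤ ℓ → weightedCount χ r (suc ℓ) m 0 ≡ weightedCount χ r ℓ m 0
    untracedRow-0 {r} {ℓ} {m} r≤ℓ = trans (weightedCount-∷ʳ 0 r≤ℓ) (sumOver-cong (allMatrices F ℓ m) λ M →
      cong (_* χ (τ r M)) (begin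
        𝟙 (rank M ℕ.≟ 0) * Q (rank M) + 0ℚ * (Q m - Q (rank M))
          ≡⟨ cong₂ _+_ (𝟙-*-Q (rank M) 0) (ℚ.*-zeroˡ (Q m - Q (rank M))) ⟩
        𝟙 (rank M ℕ.≟ 0) * 1ℚ + 0ℚ
          ≡⟨ trans (ℚ.+-identityʳ _) (ℚ.*-identityʳ _) ⟩
        𝟙 (rank M ℕ.≟ 0) ∎))

    untracedRow-suc : ∀ {r ℓ m} t → r ≤ ℓ → weightedCount χ r (suc ℓ) m (suc t)
      ≡ Q (suc t) * weightedCount χ r ℓ m (suc t) + (Q m - Q t) * weightedCount χ r ℓ m t
    untracedRow-suc {r} {ℓ} {m} t r≤ℓ = begin
      weightedCount χ r (suc ℓ) m (suc t)
        ≡⟨ weightedCount-∷ʳ (suc t) r≤ℓ ⟩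
      (Σ[ M ← Ms ] (𝟙 (rank M ℕ.≟ suc t) * Q (rank M) + 𝟙 (suc (rank M) ℕ.≟ suc t) * (Q m - Q (rank M))) * χ (τ r M))
        ≡⟨ sumOver-cong Ms (λ M → step (rank M) (χ (τ r M))) ⟩
      (Σ[ M ← Ms ] (Q (suc t) * (𝟙 (rank M ℕ.≟ suc t) * χ (τ r M)) + (Q m - Q t) * (𝟙 (rank M ℕ.≟ t) * χ (τ r M))))
        ≡⟨ sumOver-linear Ms (Q (suc t)) (Q m - Q t) (λ M → 𝟙 (rank M ℕ.≟ suc t) * χ (τ r M)) (λ M → 𝟙 (rank M ℕ.≟ t) * χ (τ r M)) ⟩
      Q (suc t) * weightedCount χ r ℓ m (suc t) + (Q m - Q t) * weightedCount χ r ℓ m t ∎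
      where
      Ms = allMatrices F ℓ m
      step : ∀ n c → (𝟙 (n ℕ.≟ suc t) * Q n + 𝟙 (suc n ℕ.≟ suc t) * (Q m - Q n)) * c
        ≡ Q (suc t) * (𝟙 (n ℕ.≟ suc t) * c) + (Q m - Q t) * (𝟙 (n ℕ.≟ t) * c)
      step n c = begin
        (𝟙 (n ℕ.≟ suc t) * Q n + 𝟙 (suc n ℕ.≟ suc t) * (Q m - Q n)) * c
          ≡⟨ cong₂ (λ x y → (x + y * (Q m - Q n)) * c) (𝟙-*-Q n (suc t)) (𝟙-suc n t) ⟩
        (𝟙 (n ℕ.≟ suc t) * Q (suc t) + 𝟙 (n ℕ.≟ t) * (Q m - Q n)) * c
          ≡⟨ solve 6 (λ x y a b d c → (x :* a :+ y :* (b :- d)) :* c := (x :* a :+ y :* b :- y :* d) :* c) refl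
               (𝟙 (n ℕ.≟ suc t)) (𝟙 (n ℕ.≟ t)) (Q (suc t)) (Q m) (Q n) c ⟩
        (𝟙 (n ℕ.≟ suc t) * Q (suc t) + 𝟙 (n ℕ.≟ t) * Q m - 𝟙 (n ℕ.≟ t) * Q n) * c
          ≡⟨ cong (λ z → (𝟙 (n ℕ.≟ suc t) * Q (suc t) + 𝟙 (n ℕ.≟ t) * Q m - z) * c) (𝟙-*-Q n t) ⟩
        (𝟙 (n ℕ.≟ suc t) * Q (suc t) + 𝟙 (n ℕ.≟ t) * Q m - 𝟙 (n ℕ.≟ t) * Q t) * c
          ≡⟨ solve 6 (λ x y a b d c → (x :* a :+ y :* b :- y :* d) :* c := a :* (x :* c) :+ (b :- d) :* (y :* c)) refl
               (𝟙 (n ℕ.≟ suc t)) (𝟙 (n ℕ.≟ t)) (Q (suc t)) (Q m) (Q t) c ⟩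
        Q (suc t) * (𝟙 (n ℕ.≟ suc t) * c) + (Q m - Q t) * (𝟙 (n ℕ.≟ t) * c) ∎

    -- The number of rows is written `k + r`, so that one more row is `suc k` by computation and the
    -- first `r` rows are always present.
    weightedCount-recurrence : ∀ r m → RankRecurrence m (λ k t → weightedCount χ r (k ℕ.+ r) m t)
    weightedCount-recurrence r m = (λ k → untracedRow-0 (ℕ.m≤n+m r k)) , (λ k t → untracedRow-suc t (ℕ.m≤n+m r k))

  -- Deleting a vanishing first column

  FirstColumnZero : ∀ {ℓ m} → Matrix F ℓ (suc m) → Set
  FirstColumnZero = All (λ v → head v ≡ F.0#)

  firstColumnZero? : ∀ {ℓ m} (M : Matrix F ℓ (suc m)) → Dec (FirstColumnZero M)
  firstColumnZero? = All.all? (λ v → head v F.≟ F.0#)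

  head-+ᵛ : ∀ {n} (u v : 𝔽^ suc n) → head (u +ᵛ v) ≡ head u F.+ head v
  head-+ᵛ (x ∷ u) (y ∷ v) = refl

  head-*ᵛ : ∀ {n} x (v : 𝔽^ suc n) → head (x *ᵛ v) ≡ x F.* head v
  head-*ᵛ x (y ∷ v) = refl

  firstColumnZero⇒head≡0 : ∀ {ℓ m} {M : Matrix F ℓ (suc m)} → FirstColumnZero M → ∀ {v} → v ∈ᵣ M → head v ≡ F.0#
  firstColumnZero⇒head≡0 []          (combination [] refl) = refl
  firstColumnZero⇒head≡0 (_∷_ {x = u} head≡0 zeros) v∈ with ∷∈ᵣ⁻ v∈
  ... | x , w , w∈ , refl = begin
    head (x *ᵛ u +ᵛ w)           ≡⟨ head-+ᵛ (x *ᵛ u) w ⟩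
    head (x *ᵛ u) F.+ head w     ≡⟨ cong₂ F._+_ (trans (head-*ᵛ x u) (trans (cong (x F.*_) head≡0) (R.zeroʳ x))) (firstColumnZero⇒head≡0 zeros w∈) ⟩
    F.0# F.+ F.0#                ≡⟨ R.+-identityˡ F.0# ⟩
    F.0#                         ∎

  ¬firstColumnZero⇒head≢0 : ∀ {ℓ m} (M : Matrix F ℓ (suc m)) → ¬ FirstColumnZero M → ∃[ u ] u ∈ᵣ M × head u ≢ F.0#
  ¬firstColumnZero⇒head≢0 []      ¬zeros = contradiction [] ¬zeros
  ¬firstColumnZero⇒head≢0 (v ∷ M) ¬zeros with head v F.≟ F.0#
  ... | no  head≢0 = v , here∈ᵣ v , head≢0
  ... | yes head≡0 with ¬firstColumnZero⇒head≢0 M (λ zeros → ¬zeros (head≡0 ∷ zeros))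
  ...   | u , u∈ , head≢0 = u , there∈ᵣ v u∈ , head≢0

  -- The indicator fixes the first entry of every row to be 0; the remaining entries run over all
  -- matrices with one column less.
  sum-firstColumnZero : ∀ ℓ m (g : Matrix F ℓ (suc m) → ℚ) →
    (Σ[ M ← allMatrices F ℓ (suc m) ] 𝟙 (firstColumnZero? M) * g M) ≡ (Σ[ M ← allMatrices F ℓ m ] g (map (F.0# ∷_) M))
  sum-firstColumnZero zero    m g = cong (_+ 0ℚ) (ℚ.*-identityˡ (g []))
  sum-firstColumnZero (suc ℓ) m g = begin
    (Σ[ M ← allMatrices F (suc ℓ) (suc m) ] 𝟙 (firstColumnZero? M) * g M)
      ≡⟨ sumOver-allVecs-suc (vectors (suc m)) ℓ _ ⟩
    (Σ[ v ← vectors (suc m) ] Σ[ M ← Ms ] 𝟙 (firstColumnZero? (v ∷ M)) * g (v ∷ M))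
      ≡⟨ sumOver-allVecs-suc F.elements m _ ⟩
    (Σ[ x ← F.elements ] Σ[ v ← vectors m ] Σ[ M ← Ms ] 𝟙 (firstColumnZero? ((x ∷ v) ∷ M)) * g ((x ∷ v) ∷ M))
      ≡⟨ sumOver-cong F.elements (λ x → trans (sumOver-cong (vectors m) λ v → trans
           (sumOver-cong Ms λ M → trans
             (cong (_* g ((x ∷ v) ∷ M)) (trans
               (𝟙-cong (firstColumnZero? ((x ∷ v) ∷ M)) ((x F.≟ F.0#) ×-dec firstColumnZero? M)
                 (λ { (x≡0 ∷ zeros) → x≡0 , zeros }) (λ (x≡0 , zeros) → x≡0 ∷ zeros))
               (𝟙-× (x F.≟ F.0#) (firstColumnZero? M))))
             (ℚ.*-assoc (𝟙 (x F.≟ F.0#)) (𝟙 (firstColumnZero? M)) (g ((x ∷ v) ∷ M))))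
           (sumOver-*ˡ Ms (𝟙 (x F.≟ F.0#)) (λ M → 𝟙 (firstColumnZero? M) * g ((x ∷ v) ∷ M))))
           (sumOver-*ˡ (vectors m) (𝟙 (x F.≟ F.0#)) (λ v → Σ[ M ← Ms ] 𝟙 (firstColumnZero? M) * g ((x ∷ v) ∷ M)))) ⟩
    (Σ[ x ← F.elements ] 𝟙 (x F.≟ F.0#) * (Σ[ v ← vectors m ] Σ[ M ← Ms ] 𝟙 (firstColumnZero? M) * g ((x ∷ v) ∷ M)))
      ≡⟨ Enumerates.pick enumerates-elements F.0# _ ⟩
    (Σ[ v ← vectors m ] Σ[ M ← Ms ] 𝟙 (firstColumnZero? M) * g ((F.0# ∷ v) ∷ M))
      ≡⟨ sumOver-cong (vectors m) (λ v → sum-firstColumnZero ℓ m (λ M → g ((F.0# ∷ v) ∷ M))) ⟩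
    (Σ[ v ← vectors m ] Σ[ M ← allMatrices F ℓ m ] g ((F.0# ∷ v) ∷ map (F.0# ∷_) M))
      ≡⟨ sumOver-allVecs-suc (vectors m) ℓ (λ M → g (map (F.0# ∷_) M)) ⟨
    (Σ[ M ← allMatrices F (suc ℓ) m ] g (map (F.0# ∷_) M)) ∎
    where Ms = allMatrices F ℓ (suc m)

  comb-0∷ : ∀ {ℓ m} (c : 𝔽^ ℓ) (M : Matrix F ℓ m) → comb c (map (F.0# ∷_) M) ≡ F.0# ∷ comb c M
  comb-0∷ []      []      = refl
  comb-0∷ (x ∷ c) (v ∷ M) = trans (cong (x *ᵛ (F.0# ∷ v) +ᵛ_) (comb-0∷ c M))
    (cong (_∷ x *ᵛ v +ᵛ comb c M) (trans (R.+-identityʳ (x F.* F.0#)) (R.zeroʳ x)))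

  -- Prepending a zero coordinate is linear and injective, so it preserves whether a row lies in the
  -- span of those below it, and `rank` depends on nothing else.
  rank-0∷ : ∀ {ℓ m} (M : Matrix F ℓ m) → rank (map (F.0# ∷_) M) ≡ rank M
  rank-0∷ []      = refl
  rank-0∷ (v ∷ M) = trans
    (cong (rank-∷ ((F.0# ∷ v) ∈ᵣ? map (F.0# ∷_) M)) (rank-0∷ M))
    (rank-∷-cong ((F.0# ∷ v) ∈ᵣ? map (F.0# ∷_) M) (v ∈ᵣ? M)
      (λ (combination c eq) → combination c (Vec.∷-injectiveʳ (trans (sym (comb-0∷ c M)) eq)))
      (λ (combination c eq) → combination c (trans (comb-0∷ c M) (cong (F.0# ∷_) eq))))
    where
    rank-∷-cong : ∀ {P R : Set} (p? : Dec P) (r? : Dec R) → (P → R) → (R → P) → ∀ {n} → rank-∷ p? n ≡ rank-∷ r? n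
    rank-∷-cong (yes _) (yes _) _ _ = refl
    rank-∷-cong (yes p) (no ¬r) f _ = contradiction (f p) ¬r
    rank-∷-cong (no ¬p) (yes r) _ g = contradiction (g r) ¬p
    rank-∷-cong (no _)  (no _)  _ _ = refl

  map-tail-0∷ : ∀ {ℓ m} (M : Matrix F ℓ m) → map tail (map (F.0# ∷_) M) ≡ M
  map-tail-0∷ M = trans (sym (Vec.map-∘ tail (F.0# ∷_) M)) (Vec.map-id M)

  -- Rows that meet the trace

  module _ (χ : F.Carrier → ℚ) (balanced : sumOver F.elements χ ≡ 0ℚ) where

    -- For `h ≠ 0` the map `x ↦ x h + a` permutes the field, with inverse `z ↦ (z - a) y` where `y`
    -- is the inverse of `h`.
    balanced-affine : ∀ {h} a → h ≢ F.0# → (Σ[ x ← F.elements ] χ (x F.* h F.+ a)) ≡ 0ℚ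
    balanced-affine {h} a h≢0 with y , hy≡1 ← F.inverse h h≢0 = trans
      (sumOver-bijection enumerates-elements (λ x → x F.* h F.+ a) (λ z → (z F.+ F.- a) F.* y)
        (λ x → begin
          (x F.* h F.+ a F.+ F.- a) F.* y  ≡⟨ cong (F._* y) (trans (R.+-assoc (x F.* h) a (F.- a)) (trans (cong (x F.* h F.+_) (R.-‿inverseʳ a)) (R.+-identityʳ (x F.* h)))) ⟩
          x F.* h F.* y                    ≡⟨ trans (R.*-assoc x h y) (cong (x F.*_) hy≡1) ⟩
          x F.* F.1#                       ≡⟨ R.*-identityʳ x ⟩
          x                                ∎)
        (λ z → begin
          (z F.+ F.- a) F.* y F.* h F.+ a  ≡⟨ cong (F._+ a) (trans (R.*-assoc (z F.+ F.- a) y h) (trans (cong ((z F.+ F.- a) F.*_) (trans (R.*-comm y h) hy≡1)) (R.*-identityʳ (z F.+ F.- a)))) ⟩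
          z F.+ F.- a F.+ a                ≡⟨ trans (R.+-assoc z (F.- a) a) (trans (cong (z F.+_) (R.-‿inverseˡ a)) (R.+-identityʳ z)) ⟩
          z                                ∎)
        χ)
      balanced

    -- The total over all rows, to be used in `sum-rank-∷`: as it vanishes, the rows outside a row
    -- space contribute the negative of those inside.
    balanced-vectors : ∀ {n} a → (Σ[ v ← vectors (suc n) ] χ (head v F.+ a)) ≡ 0ℚ
    balanced-vectors {n} a = begin
      (Σ[ v ← vectors (suc n) ] χ (head v F.+ a))
        ≡⟨ sumOver-allVecs-suc F.elements n _ ⟩
      (Σ[ x ← F.elements ] Σ[ v ← vectors n ] χ (x F.+ a))
        ≡⟨ sumOver-swap F.elements (vectors n) (λ x _ → χ (x F.+ a)) ⟩
      (Σ[ v ← vectors n ] Σ[ x ← F.elements ] χ (x F.+ a))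
        ≡⟨ sumOver-cong (vectors n) (λ _ → trans
             (sumOver-cong F.elements (λ x → cong (λ y → χ (y F.+ a)) (sym (R.*-identityʳ x))))
             (balanced-affine a (F.0≢1 ∘ sym))) ⟩
      (Σ[ v ← vectors n ] 0ℚ)
        ≡⟨ sumOver-0 (vectors n) ⟩
      0ℚ ∎

    -- Averaging over the translations of the row space by the multiples of a row with nonzero head.
    rowSpace-balanced : ∀ {ℓ m} {M : Matrix F ℓ (suc m)} {u} → u ∈ᵣ M → head u ≢ F.0# → ∀ a →
      (Σ[ v ← vectors (suc m) ] 𝟙 (v ∈ᵣ? M) * χ (head v F.+ a)) ≡ 0ℚ
    rowSpace-balanced {m = m} {M} {u} u∈ head≢0 a = *-cancelʳ-≢0 (fromℕ-≢0 q {{nonTrivial⇒nonZero q}}) (begin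
      T * fromℕ q
        ≡⟨ ℚ.*-comm T (fromℕ q) ⟩
      fromℕ q * T
        ≡⟨ sum-elements-const T ⟨
      (Σ[ x ← F.elements ] T)
        ≡⟨ sumOver-cong F.elements translate ⟩
      (Σ[ x ← F.elements ] Σ[ v ← vs ] 𝟙 (v ∈ᵣ? M) * χ (x F.* head u F.+ (head v F.+ a)))
        ≡⟨ sumOver-swap F.elements vs (λ x v → 𝟙 (v ∈ᵣ? M) * χ (x F.* head u F.+ (head v F.+ a))) ⟩
      (Σ[ v ← vs ] Σ[ x ← F.elements ] 𝟙 (v ∈ᵣ? M) * χ (x F.* head u F.+ (head v F.+ a)))
        ≡⟨ sumOver-cong vs (λ v → trans
             (sumOver-*ˡ F.elements (𝟙 (v ∈ᵣ? M)) (λ x → χ (x F.* head u F.+ (head v F.+ a))))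
             (trans (cong (𝟙 (v ∈ᵣ? M) *_) (balanced-affine (head v F.+ a) head≢0)) (ℚ.*-zeroʳ (𝟙 (v ∈ᵣ? M))))) ⟩
      (Σ[ v ← vs ] 0ℚ)
        ≡⟨ sumOver-0 vs ⟩
      0ℚ
        ≡⟨ ℚ.*-zeroˡ (fromℕ q) ⟨
      0ℚ * fromℕ q ∎)
      where
      vs = vectors (suc m)
      T  = Σ[ v ← vs ] 𝟙 (v ∈ᵣ? M) * χ (head v F.+ a)
      translate : ∀ x → T ≡ (Σ[ v ← vs ] 𝟙 (v ∈ᵣ? M) * χ (x F.* head u F.+ (head v F.+ a)))
      translate x = begin
        T ≡⟨ sumOver-bijection enumerates-vectors (λ v → v +ᵛ x *ᵛ u) (λ v → v +ᵛ (F.- x) *ᵛ u)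
               (λ v → +ᵛ-cancel x v u) (λ v → +ᵛ-cancel⁻ x v u) (λ v → 𝟙 (v ∈ᵣ? M) * χ (head v F.+ a)) ⟨
        (Σ[ v ← vs ] 𝟙 ((v +ᵛ x *ᵛ u) ∈ᵣ? M) * χ (head (v +ᵛ x *ᵛ u) F.+ a))
          ≡⟨ sumOver-cong vs (λ v → cong₂ (λ i y → i * χ y)
               (𝟙-cong ((v +ᵛ x *ᵛ u) ∈ᵣ? M) (v ∈ᵣ? M) (+ᵛ∈ᵣ⁻ x u∈) (λ v∈ → +ᵛ∈ᵣ v∈ (*ᵛ∈ᵣ x u∈)))
               (begin
                 head (v +ᵛ x *ᵛ u) F.+ a          ≡⟨ cong (F._+ a) (trans (head-+ᵛ v (x *ᵛ u)) (cong (head v F.+_) (head-*ᵛ x u))) ⟩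
                 head v F.+ x F.* head u F.+ a     ≡⟨ cong (F._+ a) (R.+-comm (head v) (x F.* head u)) ⟩
                 x F.* head u F.+ head v F.+ a     ≡⟨ R.+-assoc (x F.* head u) (head v) a ⟩
                 x F.* head u F.+ (head v F.+ a)   ∎)) ⟩
        (Σ[ v ← vs ] 𝟙 (v ∈ᵣ? M) * χ (x F.* head u F.+ (head v F.+ a))) ∎

    -- `head` is a linear functional on the row space. If it is nonzero, translations along a row
    -- space vector with nonzero head force the sum to be 0; if it is zero, each of the `q^rank`
    -- vectors contributes `χ a`.
    rowSpace-sum : ∀ {ℓ m} (M : Matrix F ℓ (suc m)) a →
      (Σ[ v ← vectors (suc m) ] 𝟙 (v ∈ᵣ? M) * χ (head v F.+ a)) ≡ 𝟙 (firstColumnZero? M) * (Q (rank M) * χ a)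
    rowSpace-sum {m = m} M a with firstColumnZero? M
    ... | no ¬zeros with u , u∈ , head≢0 ← ¬firstColumnZero⇒head≢0 M ¬zeros =
      trans (rowSpace-balanced u∈ head≢0 a) (sym (ℚ.*-zeroˡ (Q (rank M) * χ a)))
    ... | yes zeros = begin
      (Σ[ v ← vectors (suc m) ] 𝟙 (v ∈ᵣ? M) * χ (head v F.+ a))
        ≡⟨ sumOver-cong (vectors (suc m)) pointwise ⟩
      (Σ[ v ← vectors (suc m) ] 𝟙 (v ∈ᵣ? M) * χ a)
        ≡⟨ sumOver-*ʳ (vectors (suc m)) (χ a) (λ v → 𝟙 (v ∈ᵣ? M)) ⟩
      (Σ[ v ← vectors (suc m) ] 𝟙 (v ∈ᵣ? M)) * χ a
        ≡⟨ cong (_* χ a) (rowSpace-size-rank M) ⟩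
      Q (rank M) * χ a
        ≡⟨ ℚ.*-identityˡ (Q (rank M) * χ a) ⟨
      1ℚ * (Q (rank M) * χ a) ∎
      where
      pointwise : ∀ v → 𝟙 (v ∈ᵣ? M) * χ (head v F.+ a) ≡ 𝟙 (v ∈ᵣ? M) * χ a
      pointwise v with v ∈ᵣ? M
      ... | yes v∈ = cong (λ x → 1ℚ * χ x) (trans (cong (F._+ a) (firstColumnZero⇒head≡0 zeros v∈)) (R.+-identityˡ a))
      ... | no _   = trans (ℚ.*-zeroˡ (χ (head v F.+ a))) (sym (ℚ.*-zeroˡ (χ a)))

    -- Rows that keep the rank and rows that raise it contribute opposite amounts, whence the
    -- difference of the two indicators. The factor left by `rowSpace-sum` restricts to matrices
    -- with vanishing first column, and deleting that column changes neither the rank nor the trace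
    -- of what remains.
    weightedCount-∷ : ∀ r ℓ m t → weightedCount χ (suc r) (suc ℓ) (suc m) t ≡
      (Σ[ M ← allMatrices F ℓ m ] (𝟙 (rank M ℕ.≟ t) - 𝟙 (suc (rank M) ℕ.≟ t)) * (Q (rank M) * χ (τ r M)))
    weightedCount-∷ r ℓ m t = begin
      weightedCount χ (suc r) (suc ℓ) (suc m) t
        ≡⟨ sumOver-allVecs-suc vs ℓ _ ⟩
      (Σ[ v ← vs ] Σ[ M ← Ms ] 𝟙 (rank (v ∷ M) ℕ.≟ t) * χ (τ (suc r) (v ∷ M)))
        ≡⟨ sumOver-swap vs Ms (λ v M → 𝟙 (rank (v ∷ M) ℕ.≟ t) * χ (τ (suc r) (v ∷ M))) ⟩
      (Σ[ M ← Ms ] Σ[ v ← vs ] 𝟙 (rank (v ∷ M) ℕ.≟ t) * χ (τ (suc r) (v ∷ M)))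
        ≡⟨ sumOver-cong Ms inner ⟩
      (Σ[ M ← Ms ] 𝟙 (firstColumnZero? M) * g (rank M) (map tail M))
        ≡⟨ sum-firstColumnZero ℓ m (λ M → g (rank M) (map tail M)) ⟩
      (Σ[ M ← allMatrices F ℓ m ] g (rank (map (F.0# ∷_) M)) (map tail (map (F.0# ∷_) M)))
        ≡⟨ sumOver-cong (allMatrices F ℓ m) (λ M → cong₂ g (rank-0∷ M) (map-tail-0∷ M)) ⟩
      (Σ[ M ← allMatrices F ℓ m ] g (rank M) M) ∎
      where
      vs = vectors (suc m)
      Ms = allMatrices F ℓ (suc m)
      g : ℕ → Matrix F ℓ m → ℚ
      g n M = (𝟙 (n ℕ.≟ t) - 𝟙 (suc n ℕ.≟ t)) * (Q n * χ (τ r M))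
      inner : ∀ M → (Σ[ v ← vs ] 𝟙 (rank (v ∷ M) ℕ.≟ t) * χ (τ (suc r) (v ∷ M))) ≡ 𝟙 (firstColumnZero? M) * g (rank M) (map tail M)
      inner M = begin
        (Σ[ v ← vs ] 𝟙 (rank (v ∷ M) ℕ.≟ t) * χ (τ (suc r) (v ∷ M)))
          ≡⟨ sumOver-cong vs (λ v → cong (λ x → 𝟙 (rank (v ∷ M) ℕ.≟ t) * χ x) (τ-∷ r v M)) ⟩
        (Σ[ v ← vs ] 𝟙 (rank (v ∷ M) ℕ.≟ t) * χ (head v F.+ a))
          ≡⟨ sum-rank-∷ M t (λ v → χ (head v F.+ a)) ⟩
        δ * inside + δ′ * ((Σ[ v ← vs ] χ (head v F.+ a)) - inside)
          ≡⟨ cong₂ (λ i s → δ * i + δ′ * (s - i)) (rowSpace-sum M a) (balanced-vectors a) ⟩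
        δ * (z * (Q (rank M) * χ a)) + δ′ * (0ℚ - z * (Q (rank M) * χ a))
          ≡⟨ solve 4 (λ x y z w → x :* (z :* w) :+ y :* (con 0ℚ :- z :* w) := z :* ((x :- y) :* w)) refl δ δ′ z (Q (rank M) * χ a) ⟩
        z * ((δ - δ′) * (Q (rank M) * χ a)) ∎
        where
        a = τ r (map tail M)
        inside = Σ[ v ← vs ] 𝟙 (v ∈ᵣ? M) * χ (head v F.+ a)
        δ  = 𝟙 (rank M ℕ.≟ t)
        δ′ = 𝟙 (suc (rank M) ℕ.≟ t)
        z  = 𝟙 (firstColumnZero? M)

    tracedRow-0 : ∀ r ℓ m → weightedCount χ (suc r) (suc ℓ) (suc m) 0 ≡ weightedCount χ r ℓ m 0
    tracedRow-0 r ℓ m = trans (weightedCount-∷ r ℓ m 0) (sumOver-cong (allMatrices F ℓ m) λ M → begin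
      (𝟙 (rank M ℕ.≟ 0) - 0ℚ) * (Q (rank M) * χ (τ r M))
        ≡⟨ solve 3 (λ x y z → (x :- con 0ℚ) :* (y :* z) := x :* y :* z) refl (𝟙 (rank M ℕ.≟ 0)) (Q (rank M)) (χ (τ r M)) ⟩
      𝟙 (rank M ℕ.≟ 0) * Q (rank M) * χ (τ r M)
        ≡⟨ cong (_* χ (τ r M)) (trans (𝟙-*-Q (rank M) 0) (ℚ.*-identityʳ (𝟙 (rank M ℕ.≟ 0)))) ⟩
      𝟙 (rank M ℕ.≟ 0) * χ (τ r M) ∎)

    -- Compared with `untracedRow-suc`, the term `Q m` is absent because a balanced weight sums to 0
    -- over all rows. Both dimensions shrink by one, but the coefficients do not depend on them.
    tracedRow-suc : ∀ r ℓ m t → weightedCount χ (suc r) (suc ℓ) (suc m) (suc t)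
      ≡ Q (suc t) * weightedCount χ r ℓ m (suc t) + (- Q t) * weightedCount χ r ℓ m t
    tracedRow-suc r ℓ m t = begin
      weightedCount χ (suc r) (suc ℓ) (suc m) (suc t)
        ≡⟨ weightedCount-∷ r ℓ m (suc t) ⟩
      (Σ[ M ← Ms ] (𝟙 (rank M ℕ.≟ suc t) - 𝟙 (suc (rank M) ℕ.≟ suc t)) * (Q (rank M) * χ (τ r M)))
        ≡⟨ sumOver-cong Ms (λ M → step (rank M) (χ (τ r M))) ⟩
      (Σ[ M ← Ms ] (Q (suc t) * (𝟙 (rank M ℕ.≟ suc t) * χ (τ r M)) + (- Q t) * (𝟙 (rank M ℕ.≟ t) * χ (τ r M))))
        ≡⟨ sumOver-linear Ms (Q (suc t)) (- Q t) (λ M → 𝟙 (rank M ℕ.≟ suc t) * χ (τ r M)) (λ M → 𝟙 (rank M ℕ.≟ t) * χ (τ r M)) ⟩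
      Q (suc t) * weightedCount χ r ℓ m (suc t) + (- Q t) * weightedCount χ r ℓ m t ∎
      where
      Ms = allMatrices F ℓ m
      step : ∀ n c → (𝟙 (n ℕ.≟ suc t) - 𝟙 (suc n ℕ.≟ suc t)) * (Q n * c)
        ≡ Q (suc t) * (𝟙 (n ℕ.≟ suc t) * c) + (- Q t) * (𝟙 (n ℕ.≟ t) * c)
      step n c = begin
        (𝟙 (n ℕ.≟ suc t) - 𝟙 (suc n ℕ.≟ suc t)) * (Q n * c)
          ≡⟨ cong (λ y → (𝟙 (n ℕ.≟ suc t) - y) * (Q n * c)) (𝟙-suc n t) ⟩
        (𝟙 (n ℕ.≟ suc t) - 𝟙 (n ℕ.≟ t)) * (Q n * c)
          ≡⟨ solve 4 (λ x y d c → (x :- y) :* (d :* c) := (x :* d :- y :* d) :* c) refl (𝟙 (n ℕ.≟ suc t)) (𝟙 (n ℕ.≟ t)) (Q n) c ⟩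
        (𝟙 (n ℕ.≟ suc t) * Q n - 𝟙 (n ℕ.≟ t) * Q n) * c
          ≡⟨ cong₂ (λ y z → (y - z) * c) (𝟙-*-Q n (suc t)) (𝟙-*-Q n t) ⟩
        (𝟙 (n ℕ.≟ suc t) * Q (suc t) - 𝟙 (n ℕ.≟ t) * Q t) * c
          ≡⟨ solve 5 (λ x y a d c → (x :* a :- y :* d) :* c := a :* (x :* c) :+ (:- d) :* (y :* c)) refl
               (𝟙 (n ℕ.≟ suc t)) (𝟙 (n ℕ.≟ t)) (Q (suc t)) (Q t) c ⟩
        Q (suc t) * (𝟙 (n ℕ.≟ suc t) * c) + (- Q t) * (𝟙 (n ℕ.≟ t) * c) ∎

    -- The only matrix without rows has rank 0 and trace 0, which gives the factor `χ F.0#`. Once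
    -- `(-1)^t q^(t C 2)` is factored out, `tracedRow-suc` turns into the q-Pascal rule. Since
    -- `r ≤ m`, there is a column to delete for each of the `r` rows.
    fullTrace-count : ∀ r {m} t → r ≤ m → weightedCount χ r r m t ≡ χ F.0# * (-1^ t * Q (t C 2) * binomial r t)
    fullTrace-count zero    zero    _ = solve 1 (λ c → con 1ℚ :* c :+ con 0ℚ := c :* (con 1ℚ :* con 1ℚ :* con 1ℚ)) refl (χ F.0#)
    fullTrace-count zero    (suc t) _ = solve 3 (λ c x y → con 0ℚ :* c :+ con 0ℚ := c :* (x :* y :* con 0ℚ)) refl (χ F.0#) (-1^ suc t) (Q (suc t C 2))
    fullTrace-count (suc r) zero    (s≤s r≤m) = trans (tracedRow-0 r r _) (fullTrace-count r zero r≤m)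
    fullTrace-count (suc r) {suc m} (suc t) (s≤s r≤m) = begin
      weightedCount χ (suc r) (suc r) (suc m) (suc t)
        ≡⟨ tracedRow-suc r r m t ⟩
      Q (suc t) * weightedCount χ r r m (suc t) + (- Q t) * weightedCount χ r r m t
        ≡⟨ cong₂ (λ x y → Q (suc t) * x + (- Q t) * y) (fullTrace-count r (suc t) r≤m) (fullTrace-count r t r≤m) ⟩
      Q (suc t) * (c * (-1^ suc t * Q (suc t C 2) * b)) + (- Q t) * (c * (-1^ t * Q (t C 2) * b′))
        ≡⟨ cong₂ (λ x y → Q (suc t) * (c * (x * y * b)) + (- Q t) * (c * (-1^ t * Q (t C 2) * b′))) (-1^-suc t) (Q-C2-suc t) ⟩
      Q (suc t) * (c * ((- -1^ t) * (Q t * Q (t C 2)) * b)) + (- Q t) * (c * (-1^ t * Q (t C 2) * b′))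
        ≡⟨ solve 7 (λ a c e d f b b′ → a :* (c :* ((:- e) :* (d :* f) :* b)) :+ (:- d) :* (c :* (e :* f :* b′))
                      := c :* ((:- e) :* (d :* f) :* (a :* b :+ b′))) refl
             (Q (suc t)) c (-1^ t) (Q t) (Q (t C 2)) b b′ ⟩
      c * ((- -1^ t) * (Q t * Q (t C 2)) * (Q (suc t) * b + b′))
        ≡⟨ cong₂ (λ x y → c * (x * y * (Q (suc t) * b + b′))) (-1^-suc t) (Q-C2-suc t) ⟨
      c * (-1^ suc t * Q (suc t C 2) * binomial (suc r) (suc t)) ∎
      where
      c  = χ F.0#
      b  = binomial r (suc t)
      b′ = binomial r t

-- The closed formulas

module Formulas {q : ℕ} .{{q-nonTrivial : NonTrivial q}} (F : FiniteField q) where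

  open QAlgebra q
  open LinearAlgebra F
  open Counting F
  private module F = FiniteField F

  -- The sum of the nontrivial additive characters of the field.
  χ : F.Carrier → ℚ
  χ x = fromℕ q * 𝟙 (x F.≟ F.0#) - 1ℚ

  χ-balanced : sumOver F.elements χ ≡ 0ℚ
  χ-balanced = begin
    sumOver F.elements χ
      ≡⟨ sumOver-cong F.elements (λ x → solve 2 (λ a b → a :* b :- con 1ℚ := a :* b :+ (:- con 1ℚ) :* con 1ℚ) refl (fromℕ q) (𝟙 (x F.≟ F.0#))) ⟩
    (Σ[ x ← F.elements ] (fromℕ q * 𝟙 (x F.≟ F.0#) + (- 1ℚ) * 1ℚ))
      ≡⟨ sumOver-linear F.elements (fromℕ q) (- 1ℚ) (λ x → 𝟙 (x F.≟ F.0#)) (λ _ → 1ℚ) ⟩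
    fromℕ q * (Σ[ x ← F.elements ] 𝟙 (x F.≟ F.0#)) + (- 1ℚ) * (Σ[ x ← F.elements ] 1ℚ)
      ≡⟨ cong₂ (λ a b → fromℕ q * a + (- 1ℚ) * b) (Enumerates.pick-1 enumerates-elements F.0#) (sum-elements-const 1ℚ) ⟩
    fromℕ q * 1ℚ + (- 1ℚ) * (fromℕ q * 1ℚ)
      ≡⟨ solve 1 (λ a → a :* con 1ℚ :+ (:- con 1ℚ) :* (a :* con 1ℚ) := con 0ℚ) refl (fromℕ q) ⟩
    0ℚ ∎

  χ-0 : χ F.0# ≡ fromℕ q - 1ℚ
  χ-0 = cong (_- 1ℚ) (trans (cong (fromℕ q *_) (𝟙-true (F.0# F.≟ F.0#) refl)) (ℚ.*-identityʳ (fromℕ q)))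

  𝟙-hasRank : ∀ {ℓ m} (M : Matrix F ℓ m) t → 𝟙 (hasRank? F M t) ≡ 𝟙 (rank M ℕ.≟ t)
  𝟙-hasRank M t = 𝟙-cong (hasRank? F M t) (rank M ℕ.≟ t) (Equivalence.to (hasRank⇔rank M t)) (Equivalence.from (hasRank⇔rank M t))

  rankCount : (ℓ m t : ℕ) → ℚ
  rankCount = weightedCount (λ _ → 1ℚ) 0

  μ≡rankCount : ∀ t ℓ m → fromℕ (μ F t ℓ m) ≡ rankCount ℓ m t
  μ≡rankCount t ℓ m = trans (length-filter (λ M → hasRank? F M t) (allMatrices F ℓ m))
    (sumOver-cong (allMatrices F ℓ m) λ M → trans
      (𝟙-hasRank M t)
      (sym (ℚ.*-identityʳ (𝟙 (rank M ℕ.≟ t)))))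

  -- Pointwise, `q [x ≠ 0] = (q - 1) - χ x`. The factor `q` on the left keeps the identity free of
  -- division.
  𝔴≡counts : ∀ r t ℓ m .(r≤ℓ : r ≤ ℓ) .(ℓ≤m : ℓ ≤ m) →
    fromℕ (𝔴 F r t ℓ m r≤ℓ ℓ≤m) * fromℕ q ≡ (fromℕ q - 1ℚ) * rankCount ℓ m t - weightedCount χ r ℓ m t
  𝔴≡counts r t ℓ m r≤ℓ ℓ≤m = begin
    fromℕ (𝔴 F r t ℓ m r≤ℓ ℓ≤m) * fromℕ q
      ≡⟨ cong (_* fromℕ q) (length-filter counted? Ms) ⟩
    (Σ[ M ← Ms ] 𝟙 (counted? M)) * fromℕ q
      ≡⟨ sumOver-*ʳ Ms (fromℕ q) (λ M → 𝟙 (counted? M)) ⟨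
    (Σ[ M ← Ms ] 𝟙 (counted? M) * fromℕ q)
      ≡⟨ sumOver-cong Ms pointwise ⟩
    (Σ[ M ← Ms ] ((fromℕ q - 1ℚ) * (𝟙 (rank M ℕ.≟ t) * 1ℚ) + (- 1ℚ) * (𝟙 (rank M ℕ.≟ t) * χ (τ r M))))
      ≡⟨ sumOver-linear Ms (fromℕ q - 1ℚ) (- 1ℚ) (λ M → 𝟙 (rank M ℕ.≟ t) * 1ℚ) (λ M → 𝟙 (rank M ℕ.≟ t) * χ (τ r M)) ⟩
    (fromℕ q - 1ℚ) * rankCount ℓ m t + (- 1ℚ) * weightedCount χ r ℓ m t
      ≡⟨ solve 2 (λ a b → a :+ (:- con 1ℚ) :* b := a :- b) refl ((fromℕ q - 1ℚ) * rankCount ℓ m t) (weightedCount χ r ℓ m t) ⟩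
    (fromℕ q - 1ℚ) * rankCount ℓ m t - weightedCount χ r ℓ m t ∎
    where
    Ms = allMatrices F ℓ m
    trace≟0 : ∀ M → Dec (partialTrace F r r≤ℓ ℓ≤m M ≡ F.0#)
    trace≟0 M = partialTrace F r r≤ℓ ℓ≤m M F.≟ F.0#
    counted? : (M : Matrix F ℓ m) → Dec _
    counted? M = hasRank? F M t ×-dec ¬? (trace≟0 M)
    pointwise : ∀ M → 𝟙 (counted? M) * fromℕ q
      ≡ (fromℕ q - 1ℚ) * (𝟙 (rank M ℕ.≟ t) * 1ℚ) + (- 1ℚ) * (𝟙 (rank M ℕ.≟ t) * χ (τ r M))
    pointwise M = begin
      𝟙 (counted? M) * fromℕ q
        ≡⟨ cong (_* fromℕ q) (trans (𝟙-× (hasRank? F M t) (¬? (trace≟0 M))) (cong₂ _*_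
             (𝟙-hasRank M t)
             (trans (𝟙-¬ (trace≟0 M)) (cong (λ x → 1ℚ - 𝟙 (x F.≟ F.0#)) (partialTrace≡τ r r≤ℓ ℓ≤m M))))) ⟩
      𝟙 (rank M ℕ.≟ t) * (1ℚ - 𝟙 (τ r M F.≟ F.0#)) * fromℕ q
        ≡⟨ solve 3 (λ d e p → d :* (con 1ℚ :- e) :* p := (p :- con 1ℚ) :* (d :* con 1ℚ) :+ (:- con 1ℚ) :* (d :* (p :* e :- con 1ℚ)))
             refl (𝟙 (rank M ℕ.≟ t)) (𝟙 (τ r M F.≟ F.0#)) (fromℕ q) ⟩
      (fromℕ q - 1ℚ) * (𝟙 (rank M ℕ.≟ t) * 1ℚ) + (- 1ℚ) * (𝟙 (rank M ℕ.≟ t) * χ (τ r M)) ∎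

  -- The classical number of matrices of rank `t`, from the recurrence started with no rows at all:
  -- the only initial value is `[m]_q!` at rank 0, so just the term `s = 0` of the expansion is
  -- present.
  rankCount-formula : ∀ ℓ m t → t ≤ m → rankCount ℓ m t * G (m ∸ t) ≡ G m * (Q (t C 2) * binomial ℓ t)
  rankCount-formula ℓ m t t≤m = begin
    rankCount ℓ m t * G (m ∸ t)
      ≡⟨ cong (λ ℓ → rankCount ℓ m t * G (m ∸ t)) (ℕ.+-identityʳ ℓ) ⟨
    rankCount (ℓ ℕ.+ 0) m t * G (m ∸ t)
      ≡⟨ rankRecurrence-solution 0 a (weightedCount-recurrence _ 0 m) initial (λ { (suc t) _ → refl }) ℓ t t≤m ⟩
    G m * (1ℚ * (Q (t C 2) * binomial ℓ t)) + 0ℚ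
      ≡⟨ trans (ℚ.+-identityʳ _) (cong (G m *_) (ℚ.*-identityˡ _)) ⟩
    G m * (Q (t C 2) * binomial ℓ t) ∎
    where
    a : ℕ → ℚ
    a zero    = G m
    a (suc _) = 0ℚ
    initial : ∀ t → t ≤ m → rankCount 0 m t * G (m ∸ t) ≡ a t
    initial zero    _ = ℚ.*-identityˡ (G m)
    initial (suc t) _ = ℚ.*-zeroˡ (G (m ∸ suc t))

  module Sums (r k m t : ℕ) (r≤m : r ≤ m) (t≤m : t ≤ m) where

    -- `W` and `V` are the summands of the first and the second formula of the theorem, with
    -- `k = ℓ - r`. `U` is the unsigned part of `W`; its sum is the expansion of `μ`.
    U V W : ℕ → ℚ
    U s = Q (s C 2) * gaussFactorialRatio q m (m ∸ t)
            * Q (s · k) * Q ((t ∸ s) C 2) * gaussBinomial q r (+ s) * gaussBinomial q k (+ t ℤ.- + s)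
    V s = (-1^ s) * Q (s C 2) * gaussFactorialRatio q (m ∸ s) (m ∸ t)
            * Q (s · k) * Q ((t ∸ s) C 2) * gaussBinomial q r (+ s) * gaussBinomial q k (+ t ℤ.- + s)
    W s = Q (s C 2) * (gaussFactorialRatio q m (m ∸ t) - (-1^ s) * gaussFactorialRatio q (m ∸ s) (m ∸ t))
            * Q (s · k) * Q ((t ∸ s) C 2) * gaussBinomial q r (+ s) * gaussBinomial q k (+ t ℤ.- + s)

    -- Brings the summand into the shape coefficient times `kernel` in which
    -- `rankRecurrence-solution` delivers its sum.
    clear-U : ∀ s → U s * G (m ∸ t) ≡ G m * (Q (s C 2) * binomial r s) * kernel k t s
    clear-U s = begin
      U s * G (m ∸ t)
        ≡⟨ solve 7 (λ x R y z b b′ g → x :* R :* y :* z :* b :* b′ :* g := (R :* g) :* (x :* b) :* (y :* (z :* b′))) refl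
             (Q (s C 2)) (gaussFactorialRatio q m (m ∸ t)) (Q (s · k)) (Q ((t ∸ s) C 2)) (gaussBinomial q r (+ s)) (gaussBinomial q k (+ t ℤ.- + s)) (G (m ∸ t)) ⟩
      gaussFactorialRatio q m (m ∸ t) * G (m ∸ t) * (Q (s C 2) * gaussBinomial q r (+ s))
        * (Q (s · k) * (Q ((t ∸ s) C 2) * gaussBinomial q k (+ t ℤ.- + s)))
        ≡⟨ cong (λ x → x * (Q (s C 2) * gaussBinomial q r (+ s)) * (Q (s · k) * (Q ((t ∸ s) C 2) * gaussBinomial q k (+ t ℤ.- + s)))) (ratio-* m (m ∸ t)) ⟩
      G m * (Q (s C 2) * gaussBinomial q r (+ s)) * (Q (s · k) * (Q ((t ∸ s) C 2) * gaussBinomial q k (+ t ℤ.- + s)))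
        ≡⟨ cong₂ (λ b b′ → G m * (Q (s C 2) * b) * (Q (s · k) * (Q ((t ∸ s) C 2) * b′))) (gaussBinomial≡binomial r s) (gaussBinomial≡shiftedBinomial k t s) ⟩
      G m * (Q (s C 2) * binomial r s) * kernel k t s ∎

    clear-V : ∀ s → V s * G (m ∸ t) ≡ -1^ s * Q (s C 2) * binomial r s * G (m ∸ s) * kernel k t s
    clear-V s = begin
      V s * G (m ∸ t)
        ≡⟨ solve 8 (λ e x R y z b b′ g → e :* x :* R :* y :* z :* b :* b′ :* g := e :* x :* b :* (R :* g) :* (y :* (z :* b′))) refl
             (-1^ s) (Q (s C 2)) (gaussFactorialRatio q (m ∸ s) (m ∸ t)) (Q (s · k)) (Q ((t ∸ s) C 2)) (gaussBinomial q r (+ s)) (gaussBinomial q k (+ t ℤ.- + s)) (G (m ∸ t)) ⟩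
      -1^ s * Q (s C 2) * gaussBinomial q r (+ s) * (gaussFactorialRatio q (m ∸ s) (m ∸ t) * G (m ∸ t))
        * (Q (s · k) * (Q ((t ∸ s) C 2) * gaussBinomial q k (+ t ℤ.- + s)))
        ≡⟨ cong (λ x → -1^ s * Q (s C 2) * gaussBinomial q r (+ s) * x * (Q (s · k) * (Q ((t ∸ s) C 2) * gaussBinomial q k (+ t ℤ.- + s)))) (ratio-* (m ∸ s) (m ∸ t)) ⟩
      -1^ s * Q (s C 2) * gaussBinomial q r (+ s) * G (m ∸ s) * (Q (s · k) * (Q ((t ∸ s) C 2) * gaussBinomial q k (+ t ℤ.- + s)))
        ≡⟨ cong₂ (λ b b′ → -1^ s * Q (s C 2) * b * G (m ∸ s) * (Q (s · k) * (Q ((t ∸ s) C 2) * b′))) (gaussBinomial≡binomial r s) (gaussBinomial≡shiftedBinomial k t s) ⟩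
      -1^ s * Q (s C 2) * binomial r s * G (m ∸ s) * kernel k t s ∎

    sum-clear : ∀ (f h : ℕ → ℚ) → (∀ s → f s * G (m ∸ t) ≡ h s) → sumFromTo 0 r f * G (m ∸ t) ≡ sumFromTo 0 r h
    sum-clear f h eq = trans (*-distribʳ-sum (G (m ∸ t)) (λ (i : Fin (suc r)) → f (toℕ i)))
      (sum-cong-≗ {suc r} (λ i → eq (toℕ i)))

    -- The recurrence is restarted at `ℓ = r` with the values of `rankCount-formula`. Comparing the
    -- result with that formula at `ℓ = k + r` would be the q-Vandermonde identity. The sum can stop
    -- at `r` because `[r, s]_q = 0` for `s > r`.
    rankCount≡ΣU : rankCount (k ℕ.+ r) m t ≡ sumFromTo 0 r U
    rankCount≡ΣU = *-cancelʳ-≢0 (G-≢0 (m ∸ t)) (trans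
      (rankRecurrence-solution r (λ s → G m * (Q (s C 2) * binomial r s)) (weightedCount-recurrence (λ _ → 1ℚ) r m)
        (λ t t≤m → rankCount-formula r m t t≤m)
        (λ s r<s → trans (cong (λ b → G m * (Q (s C 2) * b)) (binomial-> r<s))
          (trans (cong (G m *_) (ℚ.*-zeroʳ (Q (s C 2)))) (ℚ.*-zeroʳ (G m))))
        k t t≤m)
      (sym (sum-clear U _ clear-U)))

    -- The initial values come from `fullTrace-count`, multiplied by `[m-t]_q!`. The expansion
    -- evaluates them at rank `s`, so this multiplier turns into the `[m-s]_q!` of the theorem.
    weightedCount≡ΣV : weightedCount χ r (k ℕ.+ r) m t ≡ χ F.0# * sumFromTo 0 r V
    weightedCount≡ΣV = *-cancelʳ-≢0 (G-≢0 (m ∸ t)) (begin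
      weightedCount χ r (k ℕ.+ r) m t * G (m ∸ t)
        ≡⟨ rankRecurrence-solution r (λ s → χ F.0# * (-1^ s * Q (s C 2) * binomial r s) * G (m ∸ s)) (weightedCount-recurrence χ r m)
             (λ t t≤m → cong (_* G (m ∸ t)) (fullTrace-count χ χ-balanced r t r≤m))
             (λ s r<s → trans (cong (λ b → χ F.0# * (-1^ s * Q (s C 2) * b) * G (m ∸ s)) (binomial-> r<s))
               (solve 4 (λ c e x g → c :* (e :* x :* con 0ℚ) :* g := con 0ℚ) refl (χ F.0#) (-1^ s) (Q (s C 2)) (G (m ∸ s))))
             k t t≤m ⟩
      sumFromTo 0 r (λ s → χ F.0# * (-1^ s * Q (s C 2) * binomial r s) * G (m ∸ s) * kernel k t s)
        ≡⟨ sum-cong-≗ {suc r} (λ i → term (toℕ i)) ⟩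
      sumFromTo 0 r (λ s → χ F.0# * h s)
        ≡⟨ *-distribˡ-sum (χ F.0#) (λ (i : Fin (suc r)) → h (toℕ i)) ⟨
      χ F.0# * sumFromTo 0 r h
        ≡⟨ cong (χ F.0# *_) (sum-clear V h clear-V) ⟨
      χ F.0# * (sumFromTo 0 r V * G (m ∸ t))
        ≡⟨ ℚ.*-assoc (χ F.0#) (sumFromTo 0 r V) (G (m ∸ t)) ⟨
      χ F.0# * sumFromTo 0 r V * G (m ∸ t) ∎)
      where
      h : ℕ → ℚ
      h s = -1^ s * Q (s C 2) * binomial r s * G (m ∸ s) * kernel k t s
      term : ∀ s → χ F.0# * (-1^ s * Q (s C 2) * binomial r s) * G (m ∸ s) * kernel k t s ≡ χ F.0# * h s
      term s = solve 6 (λ c e x b g y → c :* (e :* x :* b) :* g :* y := c :* (e :* x :* b :* g :* y)) refl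
        (χ F.0#) (-1^ s) (Q (s C 2)) (binomial r s) (G (m ∸ s)) (kernel k t s)

    W+V≡U : ∀ s → W s + V s ≡ U s
    W+V≡U s = solve 8 (λ x R e R′ y z b b′ → x :* (R :- e :* R′) :* y :* z :* b :* b′ :+ e :* x :* R′ :* y :* z :* b :* b′ := x :* R :* y :* z :* b :* b′) refl
      (Q (s C 2)) (gaussFactorialRatio q m (m ∸ t)) (-1^ s) (gaussFactorialRatio q (m ∸ s) (m ∸ t))
      (Q (s · k)) (Q ((t ∸ s) C 2)) (gaussBinomial q r (+ s)) (gaussBinomial q k (+ t ℤ.- + s))

    -- At `s = 0` the sign is 1 and the two ratios of factorials coincide. Therefore the sum of `W`
    -- may be taken from 0 or from 1, and the version from 0 can be compared with `U` and `V` term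
    -- by term.
    W-0 : W 0 ≡ 0ℚ
    W-0 = solve 6 (λ x R y z b b′ → x :* (R :- con 1ℚ :* R) :* y :* z :* b :* b′ := con 0ℚ) refl
      (Q (0 C 2)) (gaussFactorialRatio q m (m ∸ t)) (Q 0) (Q (t C 2)) (gaussBinomial q r (+ 0)) (gaussBinomial q k (+ t ℤ.- + 0))

    ΣW≡ : sumFromTo 1 r W ≡ rankCount (k ℕ.+ r) m t - sumFromTo 0 r V
    ΣW≡ = begin
      sumFromTo 1 r W
        ≡⟨ ℚ.+-identityˡ (sumFromTo 1 r W) ⟨
      0ℚ + sumFromTo 1 r W
        ≡⟨ cong (_+ sumFromTo 1 r W) W-0 ⟨
      sumFromTo 0 r W
        ≡⟨ solve 2 (λ x y → x := x :+ y :- y) refl (sumFromTo 0 r W) (sumFromTo 0 r V) ⟩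
      sumFromTo 0 r W + sumFromTo 0 r V - sumFromTo 0 r V
        ≡⟨ cong (_- sumFromTo 0 r V) (trans (sym (∑-distrib-+ (λ (i : Fin (suc r)) → W (toℕ i)) (λ i → V (toℕ i))))
             (sum-cong-≗ {suc r} (λ i → W+V≡U (toℕ i)))) ⟩
      sumFromTo 0 r U - sumFromTo 0 r V
        ≡⟨ cong (_- sumFromTo 0 r V) rankCount≡ΣU ⟨
      rankCount (k ℕ.+ r) m t - sumFromTo 0 r V ∎

mainTheorem17 : (q : ℕ) .{{_ : NonTrivial q}} (F : FiniteField q) (r t ℓ m : ℕ) →
    1 ≤ t → t ≤ ℓ → (ℓ≤m : ℓ ≤ m) → 1 ≤ r → (r≤ℓ : r ≤ ℓ) →
    let [q-1]/q = _/_ (+ (q ∸ 1)) q {{nonTrivial⇒nonZero q}}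
        q^_ = λ (n : ℕ) → fromℕ (q ^ n)
        _!/_! = gaussFactorialRatio q
        binom = gaussBinomial q
        rhs₁ = [q-1]/q * (∑[ s from 1 to r ]
                 (q^ (s C 2)) * ((m !/ (m ∸ t) !) - (-1^ s) * ((m ∸ s) !/ (m ∸ t) !))
                   * (q^ (s · (ℓ ∸ r))) * (q^ ((t ∸ s) C 2)) * binom r (+ s) * binom (ℓ ∸ r) (+ t ℤ.- + s))
        rhs₂ = [q-1]/q * (fromℕ (μ F t ℓ m) - (∑[ s from 0 to r ]
                 (-1^ s) * (q^ (s C 2)) * ((m ∸ s) !/ (m ∸ t) !)
                   * (q^ (s · (ℓ ∸ r))) * (q^ ((t ∸ s) C 2)) * binom r (+ s) * binom (ℓ ∸ r) (+ t ℤ.- + s)))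
    in fromℕ (𝔴 F r t ℓ m r≤ℓ ℓ≤m) ≡ rhs₁
       × rhs₁ ≡ rhs₂
       × (∀ s → t < s → binom (ℓ ∸ r) (+ t ℤ.- + s) ≡ 0ℚ)
mainTheorem17 q F r t ℓ m _ t≤ℓ ℓ≤m _ r≤ℓ = trans 𝔴≡rhs₂ (sym rhs₁≡rhs₂) , rhs₁≡rhs₂ , gaussBinomial-vanishes (ℓ ∸ r) t
  where
  open QAlgebra q
  open Counting F
  open Formulas F
  open Sums r (ℓ ∸ r) m t (ℕ.≤-trans r≤ℓ ℓ≤m) (ℕ.≤-trans t≤ℓ ℓ≤m)
  module F = FiniteField F

  instance q≢0 = nonTrivial⇒nonZero q

  ℓ∸r+r≡ℓ : ℓ ∸ r ℕ.+ r ≡ ℓ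
  ℓ∸r+r≡ℓ = ℕ.m∸n+n≡m r≤ℓ

  rhs₁≡rhs₂ : (+ (q ∸ 1) / q) * sumFromTo 1 r W ≡ (+ (q ∸ 1) / q) * (fromℕ (μ F t ℓ m) - sumFromTo 0 r V)
  rhs₁≡rhs₂ = cong ((+ (q ∸ 1) / q) *_) (trans ΣW≡ (cong (_- sumFromTo 0 r V)
    (trans (cong (λ ℓ → rankCount ℓ m t) ℓ∸r+r≡ℓ) (sym (μ≡rankCount t ℓ m)))))

  𝔴≡rhs₂ : fromℕ (𝔴 F r t ℓ m r≤ℓ ℓ≤m) ≡ (+ (q ∸ 1) / q) * (fromℕ (μ F t ℓ m) - sumFromTo 0 r V)
  𝔴≡rhs₂ = *-cancelʳ-≢0 (fromℕ-≢0 q) (begin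
    fromℕ (𝔴 F r t ℓ m r≤ℓ ℓ≤m) * fromℕ q
      ≡⟨ 𝔴≡counts r t ℓ m r≤ℓ ℓ≤m ⟩
    (fromℕ q - 1ℚ) * rankCount ℓ m t - weightedCount χ r ℓ m t
      ≡⟨ cong₂ (λ x y → (fromℕ q - 1ℚ) * x - y) (sym (μ≡rankCount t ℓ m))
           (trans (cong (λ ℓ → weightedCount χ r ℓ m t) (sym ℓ∸r+r≡ℓ))
             (trans weightedCount≡ΣV (cong (_* sumFromTo 0 r V) χ-0))) ⟩
    (fromℕ q - 1ℚ) * fromℕ (μ F t ℓ m) - (fromℕ q - 1ℚ) * sumFromTo 0 r V
      ≡⟨ solve 3 (λ c x y → c :* x :- c :* y := (x :- y) :* c) refl (fromℕ q - 1ℚ) (fromℕ (μ F t ℓ m)) (sumFromTo 0 r V) ⟩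
    (fromℕ (μ F t ℓ m) - sumFromTo 0 r V) * (fromℕ q - 1ℚ)
      ≡⟨ cong ((fromℕ (μ F t ℓ m) - sumFromTo 0 r V) *_) (trans (n/d*d≡n (q ∸ 1) q) (fromℕ-∸ (ℕ.>-nonZero⁻¹ q))) ⟨
    (fromℕ (μ F t ℓ m) - sumFromTo 0 r V) * ((+ (q ∸ 1) / q) * fromℕ q)
      ≡⟨ solve 3 (λ x y z → x :* (y :* z) := y :* x :* z) refl (fromℕ (μ F t ℓ m) - sumFromTo 0 r V) (+ (q ∸ 1) / q) (fromℕ q) ⟩
    (+ (q ∸ 1) / q) * (fromℕ (μ F t ℓ m) - sumFromTo 0 r V) * fromℕ q ∎)
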